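{- Let $p$ be an odd prime, $n\ge3$, $2\le m\le n-1$, $r=n-m$, and let $I$ be the unsaturated generalized order ideal of $\mathbb{GH}(m,n)$ in which every element of $[n]$ has multiplicity $p-1$. Let $f:\mathbb{F}_p^n\to\mathbb{F}_p$ be the characteristic function of $I(\mathbb{GP})\setminus\{0\}$ (unsaturated notion) and \[ \mathcal{C}_f=\{c(s,u)=(sf(x)+u\cdot x)_{x\in\mathbb{F}_p^n\setminus0}:\ s\in\mathbb{F}_p,\ u\in\mathbb{F}_p^n\}. \] Then $\mathcal{C}_f$ is a minimal $[p^n-1,\ n+1]$ code over $\mathbb{F}_p$, whose weights are given as follows. Put $Q=(p-1)p^{n-1}$ and write $u=(v,w)$ with $v\in\mathbb{F}_p^m$, $w\in\mathbb{F}_p^{r}$, $k=\mathrm{wt}(v)$, $\delta=[w=0]$. Then $\mathrm{wt}(c(0,u))=Q$ for $u\ne0$, $\mathrm{wt}(c(s,0))=|I(\mathbb{GP})|-1=p^m+(p-1)^m(p^r-1)-1$ for $s\neq0$, and for $s\ne0$, $u\ne0$, \[ \mathrm{wt}(c(s,u))=Q-1+p^m[v=0]+(-1)^k(p-1)^{m-k}(p^r\delta-1). \]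
   Context: $[n]=\{1,\dots,n\}$; $[\,\cdot\,]$ applied to a condition is $1$ if it holds and $0$ otherwise; $u\cdot x=\sum_i u_ix_i$; $\mathrm{wt}$ is Hamming weight. An $[N,k]$ code is a linear code of length $N$ and dimension $k$. A nonzero codeword $c$ of a linear code $\mathcal{C}$ over $\mathbb{F}_p$ is minimal if $c'\in\mathcal{C}$ and $\mathrm{supp}(c')\subseteq\mathrm{supp}(c)$ imply $c'\in\mathbb{F}_pc$; $\mathcal{C}$ is minimal if all its nonzero codewords are. Generalized order ideals: $[n]_{p-1}$ is the multiset in which each $i\in[n]$ has multiplicity $p-1$. A sub-multiset $J$ is identified with its multiplicity vector $(J_1,\dots,J_n)\in\{0,\dots,p-1\}^n=\mathbb{F}_p^n$; $J\subseteq J'$ means $J_i\le J'_i$ (as integers) for all $i$; $\bar J=\{i:J_i\ne0\}$. The hierarchical poset $\mathbb{H}(m,n)$ on $[n]$ has as its only strict relations $i\prec j$ for all $i\in[m]$, $j\in[n]\setminus[m]$; $\mathbb{GH}(m,n)$ denotes $[n]_{p-1}$ together with this order. $J$ is an unsaturated generalized order ideal if $\bar J$ is an order ideal (down-closed subset) of $\mathbb{H}(m,n)$. For an unsaturated generalized order ideal $I$, $I(\mathbb{GP})\subseteq\mathbb{F}_p^n$ is the set of all unsaturated generalized order ideals contained in $I$. Thus for the $I$ considered here, $I(\mathbb{GP})=(\mathbb{F}_p^m\times0)\cup((\mathbb{F}_p^*)^m\times(\mathbb{F}_p^{r}\setminus0))$. -}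

module Defs where

open import Data.Bool.Base using (if_then_else_)
open import Data.Fin.Base as Fin using (Fin; toℕ)
open import Data.Fin.Properties as Fin using (all?)
open import Data.Integer.Base as ℤ using (ℤ; 0ℤ; 1ℤ)
open import Data.List.Base using (List; []; _∷_; allFin; cartesianProductWith; filter; length)
open import Data.Nat.Base using (ℕ; zero; suc; NonZero; _+_; _*_; _≤_; _<_)
open import Data.Nat.DivMod using (_mod_)
open import Data.Nat.Properties as ℕ using (_≤?_; _<?_)
open import Data.Product.Base using (∃; ∃₂; _×_; _,_)
open import Data.Vec.Base as Vec using (Vec; lookup; replicate; zipWith; count; foldr′; fromList)
import Data.Vec.Properties as Vec
open import Data.Vec.Relation.Binary.Pointwise.Inductive as Pointwise using (Pointwise)
open import Level using (Level; 0ℓ; _⊔_)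
open import Relation.Binary.Bundles using (Poset; StrictPartialOrder)
open import Relation.Binary.Definitions using (DecidableEquality)
import Relation.Binary.Properties.StrictPartialOrder as SPO
open import Relation.Binary.PropositionalEquality.Core using (_≡_; _≢_; refl)
open import Relation.Binary.PropositionalEquality.Properties using (isEquivalence)
open import Relation.Nullary.Decidable using (Dec; does; ¬?; _×-dec_; _⊎-dec_; _→-dec_)
open import Relation.Unary using (Pred; Decidable; _∈_; _⊆_)

private
  variable
    a ℓ ℓ₁ ℓ₂ : Level

[[_]] : {A : Set a} → Dec A → ℤ
[[ d ]] = if does d then 1ℤ else 0ℤ

IsOrderIdeal : (P : Poset a ℓ₁ ℓ₂) → Pred (Poset.Carrier P) ℓ → Set _
IsOrderIdeal P S = ∀ i j → i ≼ j → j ∈ S → i ∈ S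
  where open Poset P renaming (_≤_ to _≼_)

-- Indices start at 0, so the set [m] is {i ∣ toℕ i < m}.
ℍ-strict : (m n : ℕ) → StrictPartialOrder 0ℓ 0ℓ 0ℓ
ℍ-strict m n = record
  { Carrier = Fin n
  ; _≈_     = _≡_
  ; _<_     = λ i j → toℕ i < m × m ≤ toℕ j
  ; isStrictPartialOrder = record
    { isEquivalence = isEquivalence
    ; irrefl   = λ { refl (i<m , m≤i) → ℕ.<⇒≱ i<m m≤i }
    ; trans    = λ { (i<m , _) (_ , m≤k) → i<m , m≤k }
    ; <-resp-≈ = (λ { refl i≺j → i≺j }) , (λ { refl i≺j → i≺j })
    }
  }

ℍ : (m n : ℕ) → Poset 0ℓ 0ℓ 0ℓ
ℍ m n = SPO.poset (ℍ-strict m n)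

-- 𝔽 is a field only when p is prime; the definitions make sense for any p ≠ 0.
module Codes (p : ℕ) .{{_ : NonZero p}} where

  𝔽 : Set
  𝔽 = Fin p

  infixl 6 _+ᶠ_
  infixl 7 _*ᶠ_

  _+ᶠ_ _*ᶠ_ : 𝔽 → 𝔽 → 𝔽
  x +ᶠ y = (toℕ x + toℕ y) mod p
  x *ᶠ y = (toℕ x * toℕ y) mod p

  0ᶠ 1ᶠ : 𝔽
  0ᶠ = 0 mod p
  1ᶠ = 1 mod p

  𝔽^_ : ℕ → Set
  𝔽^ n = Vec 𝔽 n

  infix  4 _≟ᵛ_
  infixl 6 _+ᵛ_
  infixl 7 _*ᵛ_ _∙_

  𝟎 : ∀ {n} → 𝔽^ n
  𝟎 = replicate _ 0ᶠ

  _≟ᵛ_ : ∀ {n} → DecidableEquality (𝔽^ n)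
  _≟ᵛ_ = Vec.≡-dec Fin._≟_

  _+ᵛ_ : ∀ {n} → 𝔽^ n → 𝔽^ n → 𝔽^ n
  _+ᵛ_ = zipWith _+ᶠ_

  _*ᵛ_ : ∀ {n} → 𝔽 → 𝔽^ n → 𝔽^ n
  s *ᵛ x = Vec.map (s *ᶠ_) x

  _∙_ : ∀ {n} → 𝔽^ n → 𝔽^ n → 𝔽
  u ∙ x = foldr′ _+ᶠ_ 0ᶠ (zipWith _*ᶠ_ u x)

  wt : ∀ {n} → 𝔽^ n → ℕ
  wt x = count (λ a → ¬? (a Fin.≟ 0ᶠ)) x

  supp : ∀ {n} → 𝔽^ n → Pred (Fin n) 0ℓ
  supp x i = lookup x i ≢ 0ᶠ

  supp? : ∀ {n} (x : 𝔽^ n) → Decidable (supp x)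
  supp? x i = ¬? (lookup x i Fin.≟ 0ᶠ)

  allVectors : ∀ n → List (𝔽^ n)
  allVectors zero    = Vec.[] ∷ []
  allVectors (suc n) = cartesianProductWith Vec._∷_ (allFin p) (allVectors n)

  nonzeroVectors : ∀ n → List (𝔽^ n)
  nonzeroVectors n = filter (λ x → ¬? (x ≟ᵛ 𝟎)) (allVectors n)

  card : ∀ {n} {P : Pred (𝔽^ n) ℓ} → Decidable P → ℕ
  card {n = n} P? = length (filter P? (allVectors n))

  record IsLinear {N} (C : Pred (𝔽^ N) ℓ) : Set ℓ where
    field
      0-closed : 𝟎 ∈ C
      +-closed : ∀ {x y} → x ∈ C → y ∈ C → x +ᵛ y ∈ C
      *-closed : ∀ s {x} → x ∈ C → s *ᵛ x ∈ C

  linComb : ∀ {N k} → Vec 𝔽 k → Vec (𝔽^ N) k → 𝔽^ N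
  linComb as bs = foldr′ _+ᵛ_ 𝟎 (zipWith _*ᵛ_ as bs)

  record IsBasis {N k} (C : Pred (𝔽^ N) ℓ) (bs : Vec (𝔽^ N) k) : Set ℓ where
    field
      member      : ∀ i → lookup bs i ∈ C
      independent : ∀ as → linComb as bs ≡ 𝟎 → as ≡ 𝟎
      spanning    : ∀ c → c ∈ C → ∃ λ as → c ≡ linComb as bs

  -- The ambient length L is kept apart from N because in 𝒞 below it is the
  -- length of a filtered list, which is not N definitionally.
  record Is[_,_]Code {L} (N k : ℕ) (C : Pred (𝔽^ L) ℓ) : Set ℓ where
    field
      length≡N  : L ≡ N
      isLinear  : IsLinear C
      dimension : ∃ λ (bs : Vec (𝔽^ L) k) → IsBasis C bs

  IsMinimalCodeword : ∀ {N} → Pred (𝔽^ N) ℓ → 𝔽^ N → Set ℓ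
  IsMinimalCodeword C c =
    ∀ c′ → c′ ∈ C → supp c′ ⊆ supp c → ∃ λ a → c′ ≡ a *ᵛ c

  IsMinimal : ∀ {N} → Pred (𝔽^ N) ℓ → Set ℓ
  IsMinimal C = ∀ c → c ∈ C → c ≢ 𝟎 → IsMinimalCodeword C c

  -- The order of the coordinates is the one in which nonzeroVectors lists
  -- 𝔽^ n ∖ {0}.
  codeword : ∀ {n} (f : 𝔽^ n → 𝔽) → 𝔽 → 𝔽^ n → 𝔽^ (length (nonzeroVectors n))
  codeword {n} f s u =
    Vec.map (λ x → s *ᶠ f x +ᶠ u ∙ x) (fromList (nonzeroVectors n))

  𝒞 : ∀ {n} (f : 𝔽^ n → 𝔽) → Pred (𝔽^ (length (nonzeroVectors n))) 0ℓ
  𝒞 f c = ∃₂ λ s u → c ≡ codeword f s u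

  characteristic : ∀ {n} {P : Pred (𝔽^ n) ℓ} → Decidable P → 𝔽^ n → 𝔽
  characteristic P? x = if does (P? x) then 1ᶠ else 0ᶠ

  -- A sub-multiset J of [n]_{p-1} is its multiplicity vector in 𝔽^ n, the
  -- multiplicity of i being toℕ (lookup J i); the underlying set of J is then
  -- supp J.  Containment compares multiplicities as integers (the order of Fin).

  infix 4 _⊆ₘ_ _⊆ₘ?_

  _⊆ₘ_ : ∀ {n} → 𝔽^ n → 𝔽^ n → Set
  _⊆ₘ_ = Pointwise Fin._≤_

  _⊆ₘ?_ : ∀ {n} (J J′ : 𝔽^ n) → Dec (J ⊆ₘ J′)
  _⊆ₘ?_ = Pointwise.decidable Fin._≤?_

  IsUnsaturatedIdeal : ∀ (m : ℕ) {n} → Pred (𝔽^ n) 0ℓ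
  IsUnsaturatedIdeal m {n} J = IsOrderIdeal (ℍ m n) (supp J)

  isUnsaturatedIdeal? : ∀ m {n} → Decidable (IsUnsaturatedIdeal m {n})
  isUnsaturatedIdeal? m J = all? λ i → all? λ j →
    (((toℕ i <? m) ×-dec (m ≤? toℕ j)) ⊎-dec (i Fin.≟ j))
      →-dec (supp? J j →-dec supp? J i)

  -- I(𝔾ℙ) for the poset ℍ m n.
  IdealsIn : ∀ (m : ℕ) {n} → 𝔽^ n → Pred (𝔽^ n) 0ℓ
  IdealsIn m I J = IsUnsaturatedIdeal m J × J ⊆ₘ I

  idealsIn? : ∀ m {n} (I : 𝔽^ n) → Decidable (IdealsIn m I)
  idealsIn? m I J = isUnsaturatedIdeal? m J ×-dec (J ⊆ₘ? I)

  nonzeroIdealsIn? : ∀ m {n} (I : 𝔽^ n) →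
                     Decidable (λ J → IdealsIn m I J × J ≢ 𝟎)
  nonzeroIdealsIn? m I J = idealsIn? m I J ×-dec ¬? (J ≟ᵛ 𝟎)

{-# OPTIONS --safe #-}
module Submission where

-- Write N(t) = [t ≠ 0].  Since f only takes the values 0 and 1, the integer
-- N (s f(x) + u·x) equals N (u·x) + F(x) D(u·x), where F is the indicator of
-- I(𝔾ℙ) without 0 and D(t) = N(s + t) - N(t).  Summing over all x, the weight
-- of c(s,u) is the weight of c(0,u) plus the sum of F(x) D(u·x).
--
-- For u ≠ 0 the form u·x takes each value p^(n-1) times (∑ᵛ-affine), which
-- gives the weight Q of c(0,u).  For s ≠ 0 the function D has total sum 0 and
-- D(0) = 1, so that over a whole space only a zero form contributes
-- (∑ᵛ-mean-zero), while over the vectors without zero coordinate each nonzero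
-- coordinate of v contributes a factor -1 and each zero coordinate a factor
-- p - 1 (∑ᵛ-full-mean-zero).  The decomposition of I(𝔾ℙ) into 𝔽^m × 0 and
-- (𝔽 ∖ 0)^m × (𝔽^r ∖ 0) (ideal-++, ∑-ideal) reduces the second sum to these.
--
-- Minimality and the dimension come from the zeros of the codewords.  Suppose
-- that s'f(x) + u'·x vanishes wherever s f(x) + u·x does.
--  * If s = 0 and u ≠ 0, the hyperplane u·x = 0 contains points x and 2x of
--    I(𝔾ℙ) ∖ 0, because m ≥ 2 and p is odd; comparing s' + u'·x = 0 with
--    s' + 2u'·x = 0 gives s' = 0 (vanishing-on-hyperplane), and a linear form
--    that vanishes on the hyperplane is a multiple of u (hyperplane-multiple).
--  * If s ≠ 0, subtracting a multiple of the first word makes s' = 0, and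
--    then u' = 0 because the zeros of s f(x) + u·x span 𝔽^n (zeros-span).
-- The first case also shows that c(s,u) = 0 only for s = 0 and u = 0
-- (c-trivial-kernel), so that the dimension is n + 1.

open import Defs
open import Data.Fin.Base using (toℕ)
open import Data.Integer.Base using (+_; 1ℤ; -1ℤ; _+_; _-_; _*_; _^_)
open import Data.Nat.Base as ℕ using (ℕ; NonZero; _≤_; _∸_)
open import Data.Nat.Divisibility using (_∤_)
open import Data.Nat.Primality using (Prime)
open import Data.Product.Base using (_×_)
open import Data.Vec.Base using (_++_; lookup)
open import Relation.Binary.PropositionalEquality.Core using (_≡_; _≢_)

open import Algebra.Bundles using (CommutativeRing)
open import Algebra.Consequences.Propositional
  using (comm∧idˡ⇒id; comm∧invˡ⇒inv; comm∧distrˡ⇒distr)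
import Algebra.Properties.CommutativeSemigroup
import Algebra.Properties.Ring
import Algebra.Properties.Semiring.Sum
open import Data.Bool.Base using (true; false)
open import Data.Fin.Base as Fin using (Fin; zero; suc; _↑ˡ_; _↑ʳ_)
open import Data.Fin.Permutation using (permutation)
import Data.Fin.Properties as Fin
open import Data.Integer.Base using (ℤ; 0ℤ; _⊖_)
import Data.Integer.Properties as ℤ
open import Data.Integer.Tactic.RingSolver using (solve-∀)
open import Data.List.Base as List
  using (List; []; _∷_; filter; length; cartesianProductWith; allFin; tabulate)
import Data.List.Membership.Propositional as List
open import Data.List.Membership.Propositional.Properties
  using (∈-cartesianProductWith⁺; ∈-filter⁺; ∈-allFin)
open import Data.List.Relation.Unary.Any using (here; there)
import Data.Nat.Coprimality as Coprime
open import Data.Nat.Divisibility using (_∣_; ∣⇒≤; m%n≡0⇒n∣m; ∣-refl)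
open import Data.Nat.DivMod
  using (_mod_; _%_; %-distribˡ-+; %-distribˡ-*; m<n⇒m%n≡m; n%n≡0)
open import Data.Nat.GCD using (module Bézout)
open import Data.Nat.Primality using (prime⇒nonTrivial)
import Data.Nat.Properties as ℕ
open import Data.Product.Base using (∃; _,_; proj₁; proj₂)
open import Data.Sum.Base using (inj₁; inj₂)
open import Data.Vec.Base as Vec using (Vec; []; _∷_; _[_]≔_; fromList)
import Data.Vec.Properties as Vec
open import Data.Vec.Relation.Binary.Pointwise.Inductive using ([]; _∷_)
open import Data.Vec.Relation.Unary.All as All using (All; []; _∷_)
import Data.Vec.Relation.Unary.All.Properties as All
open import Function.Base using (_∘_)
open import Level using (0ℓ; Level)
open import Relation.Binary.PropositionalEquality
  using (refl; sym; trans; cong; cong₂; subst; isEquivalence; module ≡-Reasoning)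
open import Relation.Nullary using (Dec; does; yes; no; ¬_; contradiction)
open import Relation.Nullary.Decidable
  using (¬?; _×-dec_; decidable-stable; dec-true; dec-false)
open import Relation.Unary using (Pred; Decidable)

open Algebra.Properties.Semiring.Sum ℤ.+-*-semiring
  using (sum; sum-cong-≗; ∑-distrib-+; *-distribˡ-sum; sum-permute)

private
  variable
    ℓ ℓ₁ ℓ₂ ℓ₃ : Level
    A : Set ℓ₁
    B : Set ℓ₂
    C : Set ℓ₃

-- Indicators of decidable propositions

[[]]-true : (d : Dec A) → A → [[ d ]] ≡ 1ℤ
[[]]-true d x rewrite dec-true d x = refl

[[]]-false : (d : Dec A) → ¬ A → [[ d ]] ≡ 0ℤ
[[]]-false d ¬x rewrite dec-false d ¬x = refl

[[]]-cong : (d : Dec A) (e : Dec B) → (A → B) → (B → A) → [[ d ]] ≡ [[ e ]]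
[[]]-cong (yes x) e f g = sym ([[]]-true e (f x))
[[]]-cong (no ¬x) e f g = sym ([[]]-false e (¬x ∘ g))

[[]]-¬ : (d : Dec A) → [[ ¬? d ]] ≡ 1ℤ - [[ d ]]
[[]]-¬ (yes _) = refl
[[]]-¬ (no _)  = refl

[[]]-× : (d : Dec A) (e : Dec B) → [[ d ×-dec e ]] ≡ [[ d ]] * [[ e ]]
[[]]-× d e with does d | does e
... | true  | true  = refl
... | true  | false = refl
... | false | _     = refl

-- Integer sums over lists and over Fin n

-- The sum of the values of g at the entries of a list, with repetition.
∑ˡ : List A → (A → ℤ) → ℤ
∑ˡ []       g = 0ℤ
∑ˡ (x ∷ xs) g = g x + ∑ˡ xs g

length≡∑ˡ : (xs : List A) → + length xs ≡ ∑ˡ xs (λ _ → 1ℤ)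
length≡∑ˡ []       = refl
length≡∑ˡ (x ∷ xs) = cong (_+_ 1ℤ) (length≡∑ˡ xs)

∑ˡ-filter : {P : Pred A ℓ} (P? : Decidable P) (xs : List A) (g : A → ℤ) →
            ∑ˡ (filter P? xs) g ≡ ∑ˡ xs (λ x → [[ P? x ]] * g x)
∑ˡ-filter P? []       g = refl
∑ˡ-filter P? (x ∷ xs) g with does (P? x)
... | true  = cong₂ _+_ (sym (ℤ.*-identityˡ (g x))) (∑ˡ-filter P? xs g)
... | false = trans (∑ˡ-filter P? xs g) (sym (ℤ.+-identityˡ _))

∑ˡ-++ : (xs ys : List A) (g : A → ℤ) → ∑ˡ (xs List.++ ys) g ≡ ∑ˡ xs g + ∑ˡ ys g
∑ˡ-++ []       ys g = sym (ℤ.+-identityˡ _)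
∑ˡ-++ (x ∷ xs) ys g = trans (cong (_+_ (g x)) (∑ˡ-++ xs ys g)) (sym (ℤ.+-assoc (g x) _ _))

∑ˡ-map : (h : A → B) (xs : List A) (g : B → ℤ) → ∑ˡ (List.map h xs) g ≡ ∑ˡ xs (g ∘ h)
∑ˡ-map h []       g = refl
∑ˡ-map h (x ∷ xs) g = cong (_+_ (g (h x))) (∑ˡ-map h xs g)

∑ˡ-cong : (xs : List A) {g h : A → ℤ} → (∀ x → g x ≡ h x) → ∑ˡ xs g ≡ ∑ˡ xs h
∑ˡ-cong []       eq = refl
∑ˡ-cong (x ∷ xs) eq = cong₂ _+_ (eq x) (∑ˡ-cong xs eq)

∑ˡ-cartesianProductWith : (h : A → B → C) (xs : List A) (ys : List B) (g : C → ℤ) →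
  ∑ˡ (cartesianProductWith h xs ys) g ≡ ∑ˡ xs (λ x → ∑ˡ ys (λ y → g (h x y)))
∑ˡ-cartesianProductWith h []       ys g = refl
∑ˡ-cartesianProductWith h (x ∷ xs) ys g = trans (∑ˡ-++ (List.map (h x) ys) _ g)
  (cong₂ _+_ (∑ˡ-map (h x) ys g) (∑ˡ-cartesianProductWith h xs ys g))

∑ˡ-tabulate : ∀ {n} (h : Fin n → A) (g : A → ℤ) → ∑ˡ (tabulate h) g ≡ sum (g ∘ h)
∑ˡ-tabulate {n = ℕ.zero}  h g = refl
∑ˡ-tabulate {n = ℕ.suc n} h g = cong (_+_ (g (h zero))) (∑ˡ-tabulate (h ∘ suc) g)

sum-const : ∀ n c → sum {n} (λ _ → c) ≡ + n * c
sum-const ℕ.zero    c = sym (ℤ.*-zeroˡ c)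
sum-const (ℕ.suc n) c = trans (cong (_+_ c) (sum-const n c)) (lemma c (+ n))
  where
  lemma : ∀ c k → c + k * c ≡ (1ℤ + k) * c
  lemma = solve-∀

sum-*ˡ : ∀ {n} c (g : Fin n → ℤ) → sum (λ i → c * g i) ≡ c * sum g
sum-*ˡ c g = sym (*-distribˡ-sum c g)

sum-minus : ∀ {n} (g h : Fin n → ℤ) → sum (λ i → g i - h i) ≡ sum g - sum h
sum-minus {ℕ.zero}  g h = refl
sum-minus {ℕ.suc n} g h = trans (cong (_+_ (g zero - h zero)) (sum-minus (g ∘ suc) (h ∘ suc)))
  (lemma (g zero) (h zero) (sum (g ∘ suc)) (sum (h ∘ suc)))
  where
  lemma : ∀ a b c d → a - b + (c - d) ≡ a + c - (b + d)
  lemma = solve-∀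

-- The field with p elements and linear forms over it

-- The ring laws hold because reduction modulo p is a surjective homomorphism
-- from the natural numbers (mod-+, mod-*, residue).
module PrimeField (p : ℕ) .{{_ : NonZero p}} (p-prime : Prime p) (p-odd : 2 ∤ p) where

  open Codes p

  toℕ-mod : ∀ a → toℕ (a mod p) ≡ a % p
  toℕ-mod a = Fin.toℕ-fromℕ< _

  mod-cong : ∀ {a b} → a % p ≡ b % p → a mod p ≡ b mod p
  mod-cong {a} {b} eq = Fin.toℕ-injective
    (trans (toℕ-mod a) (trans eq (sym (toℕ-mod b))))

  mod-toℕ : ∀ x → toℕ x mod p ≡ x
  mod-toℕ x = Fin.toℕ-injective (trans (toℕ-mod (toℕ x)) (m<n⇒m%n≡m (Fin.toℕ<n x)))

  mod-+ : ∀ a b → (a mod p) +ᶠ (b mod p) ≡ (a ℕ.+ b) mod p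
  mod-+ a b = mod-cong (trans
    (cong₂ (λ i j → (i ℕ.+ j) % p) (toℕ-mod a) (toℕ-mod b))
    (sym (%-distribˡ-+ a b p)))

  mod-* : ∀ a b → (a mod p) *ᶠ (b mod p) ≡ (a ℕ.* b) mod p
  mod-* a b = mod-cong (trans
    (cong₂ (λ i j → (i ℕ.* j) % p) (toℕ-mod a) (toℕ-mod b))
    (sym (%-distribˡ-* a b p)))

  -- Every element of the field is the residue of a natural number.
  residue : ∀ x → ∃ λ a → a mod p ≡ x
  residue x = toℕ x , mod-toℕ x

  +ᶠ-assoc : ∀ x y z → (x +ᶠ y) +ᶠ z ≡ x +ᶠ (y +ᶠ z)
  +ᶠ-assoc x y z with residue x | residue y | residue z
  ... | a , refl | b , refl | c , refl
    rewrite mod-+ a b | mod-+ (a ℕ.+ b) c | mod-+ b c | mod-+ a (b ℕ.+ c)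
    = cong (_mod p) (ℕ.+-assoc a b c)

  +ᶠ-comm : ∀ x y → x +ᶠ y ≡ y +ᶠ x
  +ᶠ-comm x y = cong (_mod p) (ℕ.+-comm (toℕ x) (toℕ y))

  +ᶠ-identityˡ : ∀ x → 0ᶠ +ᶠ x ≡ x
  +ᶠ-identityˡ x with residue x
  ... | a , refl = mod-+ 0 a

  -- The additive inverse of an element with representative a < p is the residue
  -- of p - a.
  -ᶠ_ : 𝔽 → 𝔽
  -ᶠ x = (p ∸ toℕ x) mod p

  p-mod : p mod p ≡ 0ᶠ
  p-mod = mod-cong (trans (n%n≡0 p) (sym (m<n⇒m%n≡m {n = p} {m = 0} (ℕ.>-nonZero⁻¹ p))))

  +ᶠ-inverseˡ : ∀ x → (-ᶠ x) +ᶠ x ≡ 0ᶠ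
  +ᶠ-inverseˡ x = begin
    (p ∸ toℕ x) mod p +ᶠ x              ≡⟨ cong (-ᶠ x +ᶠ_) (mod-toℕ x) ⟨
    (p ∸ toℕ x) mod p +ᶠ toℕ x mod p    ≡⟨ mod-+ (p ∸ toℕ x) (toℕ x) ⟩
    (p ∸ toℕ x ℕ.+ toℕ x) mod p         ≡⟨ cong (_mod p) (ℕ.m∸n+n≡m (ℕ.<⇒≤ (Fin.toℕ<n x))) ⟩
    p mod p                             ≡⟨ p-mod ⟩
    0ᶠ                                  ∎
    where open ≡-Reasoning

  *ᶠ-assoc : ∀ x y z → (x *ᶠ y) *ᶠ z ≡ x *ᶠ (y *ᶠ z)
  *ᶠ-assoc x y z with residue x | residue y | residue z
  ... | a , refl | b , refl | c , refl
    rewrite mod-* a b | mod-* (a ℕ.* b) c | mod-* b c | mod-* a (b ℕ.* c)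
    = cong (_mod p) (ℕ.*-assoc a b c)

  *ᶠ-comm : ∀ x y → x *ᶠ y ≡ y *ᶠ x
  *ᶠ-comm x y = cong (_mod p) (ℕ.*-comm (toℕ x) (toℕ y))

  *ᶠ-identityˡ : ∀ x → 1ᶠ *ᶠ x ≡ x
  *ᶠ-identityˡ x with residue x
  ... | a , refl = trans (mod-* 1 a) (cong (_mod p) (ℕ.*-identityˡ a))

  *ᶠ-distribˡ-+ᶠ : ∀ x y z → x *ᶠ (y +ᶠ z) ≡ x *ᶠ y +ᶠ x *ᶠ z
  *ᶠ-distribˡ-+ᶠ x y z with residue x | residue y | residue z
  ... | a , refl | b , refl | c , refl
    rewrite mod-+ b c | mod-* a (b ℕ.+ c) | mod-* a b | mod-* a c
          | mod-+ (a ℕ.* b) (a ℕ.* c)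
    = cong (_mod p) (ℕ.*-distribˡ-+ a b c)

  𝔽-commutativeRing : CommutativeRing 0ℓ 0ℓ
  𝔽-commutativeRing = record
    { Carrier = 𝔽 ; _≈_ = _≡_ ; _+_ = _+ᶠ_ ; _*_ = _*ᶠ_ ; -_ = -ᶠ_ ; 0# = 0ᶠ ; 1# = 1ᶠ
    ; isCommutativeRing = record
      { isRing = record
        { +-isAbelianGroup = record
          { isGroup = record
            { isMonoid = record
              { isSemigroup = record
                { isMagma = record { isEquivalence = isEquivalence ; ∙-cong = cong₂ _+ᶠ_ }
                ; assoc = +ᶠ-assoc }
              ; identity = comm∧idˡ⇒id +ᶠ-comm +ᶠ-identityˡ }
            ; inverse = comm∧invˡ⇒inv +ᶠ-comm +ᶠ-inverseˡ
            ; ⁻¹-cong = cong -ᶠ_ }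
          ; comm = +ᶠ-comm }
        ; *-cong = cong₂ _*ᶠ_
        ; *-assoc = *ᶠ-assoc
        ; *-identity = comm∧idˡ⇒id *ᶠ-comm *ᶠ-identityˡ
        ; distrib = comm∧distrˡ⇒distr (cong₂ _+ᶠ_) *ᶠ-comm *ᶠ-distribˡ-+ᶠ }
      ; *-comm = *ᶠ-comm } }

  open CommutativeRing 𝔽-commutativeRing public
    using (ring; +-commutativeSemigroup; *-commutativeSemigroup)
    renaming ( distribʳ to *ᶠ-distribʳ-+ᶠ; zeroˡ to *ᶠ-zeroˡ; zeroʳ to *ᶠ-zeroʳ
             ; *-identityʳ to *ᶠ-identityʳ
             ; +-identityʳ to +ᶠ-identityʳ; -‿inverseʳ to +ᶠ-inverseʳ )
  open Algebra.Properties.Ring ring public using ()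
    renaming ( -‿distribˡ-* to -ᶠ-distribˡ-*ᶠ; -‿distribʳ-* to -ᶠ-distribʳ-*ᶠ
             ; +-cancelˡ to +ᶠ-cancelˡ; +-cancelʳ to +ᶠ-cancelʳ
             ; +-inverseˡ-unique to +ᶠ-inverseˡ-unique )

  open Algebra.Properties.CommutativeSemigroup +-commutativeSemigroup public using ()
    renaming (interchange to +ᶠ-interchange)
  open Algebra.Properties.CommutativeSemigroup *-commutativeSemigroup public using ()
    renaming (x∙yz≈y∙zx to *ᶠ-rotate)

  -- Bézout's identity for p and the representative of x.  In its first form
  -- 1 + b x is a multiple of p, so the inverse is -b; in the second it is b.
  inverse : ∀ x → x ≢ 0ᶠ → ∃ λ y → x *ᶠ y ≡ 1ᶠ
  inverse x x≢0 with Coprime.coprime-Bézout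
    (Coprime.prime⇒coprime p-prime {{x-nonZero}} (Fin.toℕ<n x))
    where
    x-nonZero : NonZero (toℕ x)
    x-nonZero = ℕ.≢-nonZero λ eq → x≢0 (trans (sym (mod-toℕ x)) (cong (_mod p) eq))
  ... | Bézout.+- a b eq = -ᶠ (b mod p) , (begin
    x *ᶠ (-ᶠ b′)   ≡⟨ -ᶠ-distribʳ-*ᶠ x b′ ⟨
    -ᶠ (x *ᶠ b′)   ≡⟨ +ᶠ-inverseˡ-unique _ _ 1+xb≡0 ⟨
    1ᶠ             ∎)
    where
    open ≡-Reasoning
    b′ = b mod p
    1+xb≡0 : 1ᶠ +ᶠ x *ᶠ b′ ≡ 0ᶠ
    1+xb≡0 = begin
      1ᶠ +ᶠ x *ᶠ b′                     ≡⟨ cong (1ᶠ +ᶠ_) (*ᶠ-comm x b′) ⟩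
      1ᶠ +ᶠ b′ *ᶠ x                     ≡⟨ cong (λ z → 1ᶠ +ᶠ b′ *ᶠ z) (mod-toℕ x) ⟨
      1ᶠ +ᶠ b′ *ᶠ (toℕ x mod p)         ≡⟨ cong (1ᶠ +ᶠ_) (mod-* b (toℕ x)) ⟩
      1ᶠ +ᶠ (b ℕ.* toℕ x) mod p         ≡⟨ mod-+ 1 (b ℕ.* toℕ x) ⟩
      (1 ℕ.+ b ℕ.* toℕ x) mod p         ≡⟨ cong (_mod p) eq ⟩
      (a ℕ.* p) mod p                   ≡⟨ mod-* a p ⟨
      (a mod p) *ᶠ (p mod p)            ≡⟨ cong ((a mod p) *ᶠ_) p-mod ⟩
      (a mod p) *ᶠ 0ᶠ                   ≡⟨ *ᶠ-zeroʳ (a mod p) ⟩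
      0ᶠ                                ∎
  ... | Bézout.-+ a b eq = b mod p , (begin
    x *ᶠ (b mod p)                    ≡⟨ *ᶠ-comm x (b mod p) ⟩
    (b mod p) *ᶠ x                    ≡⟨ cong ((b mod p) *ᶠ_) (mod-toℕ x) ⟨
    (b mod p) *ᶠ (toℕ x mod p)        ≡⟨ mod-* b (toℕ x) ⟩
    (b ℕ.* toℕ x) mod p               ≡⟨ cong (_mod p) eq ⟨
    (1 ℕ.+ a ℕ.* p) mod p             ≡⟨ mod-+ 1 (a ℕ.* p) ⟨
    1ᶠ +ᶠ (a ℕ.* p) mod p             ≡⟨ cong (1ᶠ +ᶠ_) (mod-* a p) ⟨
    1ᶠ +ᶠ (a mod p) *ᶠ (p mod p)      ≡⟨ cong (λ z → 1ᶠ +ᶠ (a mod p) *ᶠ z) p-mod ⟩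
    1ᶠ +ᶠ (a mod p) *ᶠ 0ᶠ             ≡⟨ cong (1ᶠ +ᶠ_) (*ᶠ-zeroʳ (a mod p)) ⟩
    1ᶠ +ᶠ 0ᶠ                          ≡⟨ +ᶠ-identityʳ 1ᶠ ⟩
    1ᶠ                                ∎)
    where open ≡-Reasoning

  inverse-cancels : ∀ x y z → x *ᶠ y ≡ 1ᶠ → x *ᶠ (y *ᶠ z) ≡ z
  inverse-cancels x y z xy≡1 =
    trans (sym (*ᶠ-assoc x y z)) (trans (cong (_*ᶠ z) xy≡1) (*ᶠ-identityˡ z))

  x-y≡0⇒x≡y : ∀ x y → x +ᶠ -ᶠ y ≡ 0ᶠ → x ≡ y
  x-y≡0⇒x≡y x y eq = +ᶠ-cancelʳ (-ᶠ y) x y (trans eq (sym (+ᶠ-inverseʳ y)))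

  *ᶠ-cancel-0 : ∀ {x y} → x ≢ 0ᶠ → x *ᶠ y ≡ 0ᶠ → y ≡ 0ᶠ
  *ᶠ-cancel-0 {x} {y} x≢0 xy≡0 with inverse x x≢0
  ... | x⁻¹ , xx⁻¹≡1 = begin
    y                     ≡⟨ inverse-cancels x⁻¹ x y (trans (*ᶠ-comm x⁻¹ x) xx⁻¹≡1) ⟨
    x⁻¹ *ᶠ (x *ᶠ y)       ≡⟨ cong (x⁻¹ *ᶠ_) xy≡0 ⟩
    x⁻¹ *ᶠ 0ᶠ             ≡⟨ *ᶠ-zeroʳ x⁻¹ ⟩
    0ᶠ                    ∎
    where open ≡-Reasoning

  -- The only consequence of p being odd that the proof needs.
  2ᶠ≢0 : 1ᶠ +ᶠ 1ᶠ ≢ 0ᶠ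
  2ᶠ≢0 eq = p-odd (subst (2 ∣_) 2≡p ∣-refl)
    where
    open ≡-Reasoning
    p∣2 : p ∣ 2
    p∣2 = m%n≡0⇒n∣m 2 p (begin
      2 % p           ≡⟨ toℕ-mod 2 ⟨
      toℕ (2 mod p)   ≡⟨ cong toℕ (trans (sym (mod-+ 1 1)) eq) ⟩
      toℕ 0ᶠ          ≡⟨ toℕ-mod 0 ⟩
      0 % p           ≡⟨ m<n⇒m%n≡m {n = p} {m = 0} (ℕ.>-nonZero⁻¹ p) ⟩
      0               ∎)
    2≡p : 2 ≡ p
    2≡p = ℕ.≤-antisym (ℕ.nonTrivial⇒n>1 p {{prime⇒nonTrivial p-prime}}) (∣⇒≤ p∣2)

  1ᶠ≢0 : 1ᶠ ≢ 0ᶠ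
  1ᶠ≢0 eq = 2ᶠ≢0 (trans (cong₂ _+ᶠ_ eq eq) (+ᶠ-identityˡ 0ᶠ))

  double≡0 : ∀ {x} → x +ᶠ x ≡ 0ᶠ → x ≡ 0ᶠ
  double≡0 {x} eq = *ᶠ-cancel-0 2ᶠ≢0 (
    trans (*ᶠ-distribʳ-+ᶠ x 1ᶠ 1ᶠ) (trans (cong₂ _+ᶠ_ (*ᶠ-identityˡ x) (*ᶠ-identityˡ x)) eq))

  -- Linear forms

  𝟎-++ : ∀ m r → 𝟎 {m} ++ 𝟎 {r} ≡ 𝟎
  𝟎-++ ℕ.zero    r = refl
  𝟎-++ (ℕ.suc m) r = cong (0ᶠ ∷_) (𝟎-++ m r)

  ∙-comm : ∀ {n} (u x : 𝔽^ n) → u ∙ x ≡ x ∙ u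
  ∙-comm []      []      = refl
  ∙-comm (a ∷ u) (b ∷ x) = cong₂ _+ᶠ_ (*ᶠ-comm a b) (∙-comm u x)

  ∙-distribʳ : ∀ {n} (x u u′ : 𝔽^ n) → (u +ᵛ u′) ∙ x ≡ u ∙ x +ᶠ u′ ∙ x
  ∙-distribʳ []      []      []        = sym (+ᶠ-identityˡ 0ᶠ)
  ∙-distribʳ (c ∷ x) (a ∷ u) (a′ ∷ u′) =
    trans (cong₂ _+ᶠ_ (*ᶠ-distribʳ-+ᶠ c a a′) (∙-distribʳ x u u′))
    (+ᶠ-interchange (a *ᶠ c) (a′ *ᶠ c) (u ∙ x) (u′ ∙ x))

  ∙-*ˡ : ∀ {n} s (u x : 𝔽^ n) → (s *ᵛ u) ∙ x ≡ s *ᶠ (u ∙ x)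
  ∙-*ˡ s []      []      = sym (*ᶠ-zeroʳ s)
  ∙-*ˡ s (a ∷ u) (c ∷ x) =
    trans (cong₂ _+ᶠ_ (*ᶠ-assoc s a c) (∙-*ˡ s u x)) (sym (*ᶠ-distribˡ-+ᶠ s (a *ᶠ c) (u ∙ x)))

  ∙-distribˡ : ∀ {n} (u x y : 𝔽^ n) → u ∙ (x +ᵛ y) ≡ u ∙ x +ᶠ u ∙ y
  ∙-distribˡ u x y = trans (∙-comm u _) (trans (∙-distribʳ u x y)
    (cong₂ _+ᶠ_ (∙-comm x u) (∙-comm y u)))

  ∙-zeroˡ : ∀ {n} (x : 𝔽^ n) → 𝟎 ∙ x ≡ 0ᶠ
  ∙-zeroˡ []      = refl
  ∙-zeroˡ (c ∷ x) = trans (cong₂ _+ᶠ_ (*ᶠ-zeroˡ c) (∙-zeroˡ x)) (+ᶠ-identityˡ 0ᶠ)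

  ∙-zeroʳ : ∀ {n} (u : 𝔽^ n) → u ∙ 𝟎 ≡ 0ᶠ
  ∙-zeroʳ u = trans (∙-comm u 𝟎) (∙-zeroˡ u)

  ∙-++ : ∀ {m r} (v a : 𝔽^ m) (w b : 𝔽^ r) → (v ++ w) ∙ (a ++ b) ≡ v ∙ a +ᶠ w ∙ b
  ∙-++ []      []      w b = sym (+ᶠ-identityˡ _)
  ∙-++ (c ∷ v) (d ∷ a) w b = trans (cong (_ +ᶠ_) (∙-++ v a w b)) (sym (+ᶠ-assoc _ _ _))

  ∙-++𝟎 : ∀ {m r} (v a : 𝔽^ m) (w : 𝔽^ r) → (v ++ w) ∙ (a ++ 𝟎) ≡ v ∙ a
  ∙-++𝟎 v a w = trans (∙-++ v a w 𝟎) (trans (cong (v ∙ a +ᶠ_) (∙-zeroʳ w)) (+ᶠ-identityʳ (v ∙ a)))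

  -- The vector c eᵢ, whose only possibly nonzero coordinate is c at i.
  single : ∀ {n} → Fin n → 𝔽 → 𝔽^ n
  single i c = 𝟎 [ i ]≔ c

  ∙-single : ∀ {n} (u : 𝔽^ n) i c → u ∙ single i c ≡ lookup u i *ᶠ c
  ∙-single (a ∷ u) zero    c = trans (cong (a *ᶠ c +ᶠ_) (∙-zeroʳ u)) (+ᶠ-identityʳ _)
  ∙-single (a ∷ u) (suc i) c =
    trans (cong₂ _+ᶠ_ (*ᶠ-zeroʳ a) (∙-single u i c)) (+ᶠ-identityˡ _)

  ≢𝟎⇒∃≢0 : ∀ {n} (u : 𝔽^ n) → u ≢ 𝟎 → ∃ λ i → lookup u i ≢ 0ᶠ
  ≢𝟎⇒∃≢0 []      u≢𝟎 = contradiction refl u≢𝟎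
  ≢𝟎⇒∃≢0 (a ∷ u) u≢𝟎 with a Fin.≟ 0ᶠ
  ... | no a≢0   = zero , a≢0
  ... | yes refl with ≢𝟎⇒∃≢0 u (λ { refl → u≢𝟎 refl })
  ...   | i , uᵢ≢0 = suc i , uᵢ≢0

  lookup-ext : ∀ {n} {x y : Vec A n} → (∀ i → lookup x i ≡ lookup y i) → x ≡ y
  lookup-ext {x = x} {y} eq = trans (sym (Vec.tabulate∘lookup x))
    (trans (Vec.tabulate-cong eq) (Vec.tabulate∘lookup y))

  lookup≡0⇒𝟎 : ∀ {n} (u : 𝔽^ n) → (∀ i → lookup u i ≡ 0ᶠ) → u ≡ 𝟎
  lookup≡0⇒𝟎 u eq = lookup-ext λ i → trans (eq i) (sym (Vec.lookup-replicate i 0ᶠ))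

  ∙-nondegenerate : ∀ {n} (u : 𝔽^ n) → (∀ x → u ∙ x ≡ 0ᶠ) → u ≡ 𝟎
  ∙-nondegenerate u eq = lookup≡0⇒𝟎 u λ i → begin
    lookup u i           ≡⟨ *ᶠ-identityʳ (lookup u i) ⟨
    lookup u i *ᶠ 1ᶠ     ≡⟨ ∙-single u i 1ᶠ ⟨
    u ∙ single i 1ᶠ      ≡⟨ eq _ ⟩
    0ᶠ                   ∎
    where open ≡-Reasoning

  ∙-surjective : ∀ {n} (u : 𝔽^ n) → u ≢ 𝟎 → ∀ t → ∃ λ x → u ∙ x ≡ t
  ∙-surjective u u≢𝟎 t with ≢𝟎⇒∃≢0 u u≢𝟎
  ... | i , uᵢ≢0 with inverse (lookup u i) uᵢ≢0
  ...   | y , uᵢy≡1 = single i (y *ᶠ t) ,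
    trans (∙-single u i (y *ᶠ t)) (inverse-cancels (lookup u i) y t uᵢy≡1)

  -- A linear form that vanishes on the kernel of a nonzero form is a multiple
  -- of it: the kernel contains  uᵢ eⱼ - uⱼ eᵢ,  where uᵢ is invertible.
  hyperplane-multiple : ∀ {n} (u u′ : 𝔽^ n) → u ≢ 𝟎 →
    (∀ x → u ∙ x ≡ 0ᶠ → u′ ∙ x ≡ 0ᶠ) → ∃ λ a → u′ ≡ a *ᵛ u
  hyperplane-multiple u u′ u≢𝟎 H with ≢𝟎⇒∃≢0 u u≢𝟎
  ... | i , uᵢ≢0 with inverse (lookup u i) uᵢ≢0
  ...   | y , uᵢy≡1 = a , lookup-ext λ j → begin
    u′ [ j ]                      ≡⟨ inverse-cancels (u [ i ]) y (u′ [ j ]) uᵢy≡1 ⟨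
    u [ i ] *ᶠ (y *ᶠ u′ [ j ])    ≡⟨ *ᶠ-rotate (u [ i ]) y (u′ [ j ]) ⟩
    y *ᶠ (u′ [ j ] *ᶠ u [ i ])    ≡⟨ cong (y *ᶠ_) (cross j) ⟩
    y *ᶠ (u′ [ i ] *ᶠ u [ j ])    ≡⟨ *ᶠ-assoc y (u′ [ i ]) (u [ j ]) ⟨
    a *ᶠ u [ j ]                  ≡⟨ Vec.lookup-map j (a *ᶠ_) u ⟨
    lookup (a *ᵛ u) j             ∎
    where
    open ≡-Reasoning
    infix 8 _[_]
    _[_] : ∀ {n} → 𝔽^ n → Fin n → 𝔽
    _[_] = lookup
    a = y *ᶠ u′ [ i ]
    point : Fin _ → 𝔽^ _
    point j = single j (u [ i ]) +ᵛ single i (-ᶠ (u [ j ]))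
    ∙-point : ∀ z j → z ∙ point j ≡ z [ j ] *ᶠ u [ i ] +ᶠ -ᶠ (z [ i ] *ᶠ u [ j ])
    ∙-point z j = begin
      z ∙ point j
        ≡⟨ ∙-distribˡ z (single j (u [ i ])) (single i (-ᶠ (u [ j ]))) ⟩
      z ∙ single j (u [ i ]) +ᶠ z ∙ single i (-ᶠ (u [ j ]))
        ≡⟨ cong₂ _+ᶠ_ (∙-single z j (u [ i ])) (∙-single z i (-ᶠ (u [ j ]))) ⟩
      z [ j ] *ᶠ u [ i ] +ᶠ z [ i ] *ᶠ (-ᶠ (u [ j ]))
        ≡⟨ cong (z [ j ] *ᶠ u [ i ] +ᶠ_) (-ᶠ-distribʳ-*ᶠ (z [ i ]) (u [ j ])) ⟨
      z [ j ] *ᶠ u [ i ] +ᶠ -ᶠ (z [ i ] *ᶠ u [ j ])  ∎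
    on-hyperplane : ∀ j → u ∙ point j ≡ 0ᶠ
    on-hyperplane j = begin
      u ∙ point j                                     ≡⟨ ∙-point u j ⟩
      u [ j ] *ᶠ u [ i ] +ᶠ -ᶠ (u [ i ] *ᶠ u [ j ])
        ≡⟨ cong (_+ᶠ -ᶠ (u [ i ] *ᶠ u [ j ])) (*ᶠ-comm (u [ j ]) (u [ i ])) ⟩
      u [ i ] *ᶠ u [ j ] +ᶠ -ᶠ (u [ i ] *ᶠ u [ j ])   ≡⟨ +ᶠ-inverseʳ (u [ i ] *ᶠ u [ j ]) ⟩
      0ᶠ                                              ∎
    cross : ∀ j → u′ [ j ] *ᶠ u [ i ] ≡ u′ [ i ] *ᶠ u [ j ]
    cross j = x-y≡0⇒x≡y (u′ [ j ] *ᶠ u [ i ]) (u′ [ i ] *ᶠ u [ j ])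
      (trans (sym (∙-point u′ j)) (H (point j) (on-hyperplane j)))

  -- An affine hyperplane that misses 0 spans the whole space, here stated for
  -- the linear forms u′: the form 0 is the only one that vanishes on it.
  affine-hyperplane-spans : ∀ {n} (u u′ : 𝔽^ n) {t} → u ≢ 𝟎 → t ≢ 0ᶠ →
    (∀ x → u ∙ x ≡ t → u′ ∙ x ≡ 0ᶠ) → u′ ≡ 𝟎
  affine-hyperplane-spans u u′ {t} u≢𝟎 t≢0 H with ∙-surjective u u≢𝟎 t
  ... | y , uy≡t with hyperplane-multiple u u′ u≢𝟎 direction
    where
    direction : ∀ x → u ∙ x ≡ 0ᶠ → u′ ∙ x ≡ 0ᶠ
    direction x ux≡0 = begin
      u′ ∙ x                    ≡⟨ +ᶠ-identityʳ (u′ ∙ x) ⟨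
      u′ ∙ x +ᶠ 0ᶠ              ≡⟨ cong (u′ ∙ x +ᶠ_) (H y uy≡t) ⟨
      u′ ∙ x +ᶠ u′ ∙ y          ≡⟨ ∙-distribˡ u′ x y ⟨
      u′ ∙ (x +ᵛ y)             ≡⟨ H (x +ᵛ y) (trans (∙-distribˡ u x y)
                                     (trans (cong₂ _+ᶠ_ ux≡0 uy≡t) (+ᶠ-identityˡ t))) ⟩
      0ᶠ                        ∎
      where open ≡-Reasoning
  ...   | a , refl = ∙-nondegenerate _ λ x → trans (∙-*ˡ a u x)
          (trans (cong (_*ᶠ (u ∙ x)) a≡0) (*ᶠ-zeroˡ (u ∙ x)))
    where
    a≡0 : a ≡ 0ᶠ
    a≡0 = *ᶠ-cancel-0 t≢0 (begin
      t *ᶠ a              ≡⟨ *ᶠ-comm t a ⟩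
      a *ᶠ t              ≡⟨ cong (a *ᶠ_) uy≡t ⟨
      a *ᶠ (u ∙ y)        ≡⟨ ∙-*ˡ a u y ⟨
      (a *ᵛ u) ∙ y        ≡⟨ H y uy≡t ⟩
      0ᶠ                  ∎)
      where open ≡-Reasoning

-- Integer sums over 𝔽^n

module VectorSums (p : ℕ) .{{_ : NonZero p}} (p-prime : Prime p) (p-odd : 2 ∤ p) where

  open Codes p
  open PrimeField p p-prime p-odd

  sum-δ : (g : 𝔽 → ℤ) → sum (λ t → [[ t Fin.≟ 0ᶠ ]] * g t) ≡ g 0ᶠ
  sum-δ = at-zero p
    where
    -- For n = suc k the residue 0 mod n computes to the constructor zero.
    at-zero : ∀ n .{{_ : NonZero n}} (g : Fin n → ℤ) →
              sum (λ t → [[ t Fin.≟ (0 mod n) ]] * g t) ≡ g (0 mod n)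
    at-zero (ℕ.suc n) g = begin
      1ℤ * g zero + sum (λ t → 0ℤ * g (suc t))
        ≡⟨ cong₂ _+_ (ℤ.*-identityˡ (g zero)) (sum-*ˡ 0ℤ (g ∘ suc)) ⟩
      g zero + 0ℤ * sum (g ∘ suc)
        ≡⟨ cong (_+_ (g zero)) (ℤ.*-zeroˡ (sum (g ∘ suc))) ⟩
      g zero + 0ℤ                               ≡⟨ ℤ.+-identityʳ (g zero) ⟩
      g zero                                    ∎
      where open ≡-Reasoning

  -- t ↦ s + c t permutes the field when c is nonzero.
  sum-affine : ∀ s {c} → c ≢ 0ᶠ → (g : 𝔽 → ℤ) → sum (λ t → g (s +ᶠ c *ᶠ t)) ≡ sum g
  sum-affine s {c} c≢0 g with inverse c c≢0
  ... | d , cd≡1 = sym (sum-permute g (permutation to from to∘from from∘to))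
    where
    open ≡-Reasoning
    to from : 𝔽 → 𝔽
    to t = s +ᶠ c *ᶠ t
    from t = d *ᶠ ((-ᶠ s) +ᶠ t)
    to∘from : ∀ t → to (from t) ≡ t
    to∘from t = begin
      s +ᶠ c *ᶠ (d *ᶠ ((-ᶠ s) +ᶠ t))
        ≡⟨ cong (s +ᶠ_) (inverse-cancels c d ((-ᶠ s) +ᶠ t) cd≡1) ⟩
      s +ᶠ ((-ᶠ s) +ᶠ t)               ≡⟨ +ᶠ-assoc s (-ᶠ s) t ⟨
      (s +ᶠ (-ᶠ s)) +ᶠ t               ≡⟨ cong (_+ᶠ t) (+ᶠ-inverseʳ s) ⟩
      0ᶠ +ᶠ t                          ≡⟨ +ᶠ-identityˡ t ⟩
      t                                ∎
    from∘to : ∀ t → from (to t) ≡ t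
    from∘to t = begin
      d *ᶠ ((-ᶠ s) +ᶠ (s +ᶠ c *ᶠ t))   ≡⟨ cong (d *ᶠ_) (+ᶠ-assoc (-ᶠ s) s (c *ᶠ t)) ⟨
      d *ᶠ (((-ᶠ s) +ᶠ s) +ᶠ c *ᶠ t)   ≡⟨ cong (λ z → d *ᶠ (z +ᶠ c *ᶠ t)) (+ᶠ-inverseˡ s) ⟩
      d *ᶠ (0ᶠ +ᶠ c *ᶠ t)              ≡⟨ cong (d *ᶠ_) (+ᶠ-identityˡ (c *ᶠ t)) ⟩
      d *ᶠ (c *ᶠ t)                    ≡⟨ inverse-cancels d c t (trans (*ᶠ-comm d c) cd≡1) ⟩
      t                                ∎

  -- The sum of an integer-valued function over 𝔽^ n, one coordinate at a time.
  ∑ᵛ : ∀ n → (𝔽^ n → ℤ) → ℤ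
  ∑ᵛ ℕ.zero    g = g []
  ∑ᵛ (ℕ.suc n) g = sum λ t → ∑ᵛ n λ x → g (t ∷ x)

  ∑ˡ-allVectors : ∀ n (g : 𝔽^ n → ℤ) → ∑ˡ (allVectors n) g ≡ ∑ᵛ n g
  ∑ˡ-allVectors ℕ.zero    g = ℤ.+-identityʳ (g [])
  ∑ˡ-allVectors (ℕ.suc n) g = trans (∑ˡ-cartesianProductWith _∷_ (allFin p) (allVectors n) g)
    (trans (∑ˡ-cong (allFin p) λ t → ∑ˡ-allVectors n λ x → g (t ∷ x))
           (∑ˡ-tabulate (λ t → t) λ t → ∑ᵛ n λ x → g (t ∷ x)))

  ∑ᵛ-cong : ∀ n {g h : 𝔽^ n → ℤ} → (∀ x → g x ≡ h x) → ∑ᵛ n g ≡ ∑ᵛ n h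
  ∑ᵛ-cong ℕ.zero    eq = eq []
  ∑ᵛ-cong (ℕ.suc n) eq = sum-cong-≗ λ t → ∑ᵛ-cong n λ x → eq (t ∷ x)

  ∑ᵛ-+ : ∀ n (g h : 𝔽^ n → ℤ) → ∑ᵛ n (λ x → g x + h x) ≡ ∑ᵛ n g + ∑ᵛ n h
  ∑ᵛ-+ ℕ.zero    g h = refl
  ∑ᵛ-+ (ℕ.suc n) g h = trans (sum-cong-≗ λ t → ∑ᵛ-+ n (λ x → g (t ∷ x)) (λ x → h (t ∷ x)))
    (∑-distrib-+ (λ t → ∑ᵛ n λ x → g (t ∷ x)) (λ t → ∑ᵛ n λ x → h (t ∷ x)))

  ∑ᵛ-minus : ∀ n (g h : 𝔽^ n → ℤ) → ∑ᵛ n (λ x → g x - h x) ≡ ∑ᵛ n g - ∑ᵛ n h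
  ∑ᵛ-minus ℕ.zero    g h = refl
  ∑ᵛ-minus (ℕ.suc n) g h = trans (sum-cong-≗ λ t → ∑ᵛ-minus n (λ x → g (t ∷ x)) (λ x → h (t ∷ x)))
    (sum-minus (λ t → ∑ᵛ n λ x → g (t ∷ x)) (λ t → ∑ᵛ n λ x → h (t ∷ x)))

  ∑ᵛ-*ˡ : ∀ n c (g : 𝔽^ n → ℤ) → ∑ᵛ n (λ x → c * g x) ≡ c * ∑ᵛ n g
  ∑ᵛ-*ˡ ℕ.zero    c g = refl
  ∑ᵛ-*ˡ (ℕ.suc n) c g = trans (sum-cong-≗ λ t → ∑ᵛ-*ˡ n c (λ x → g (t ∷ x)))
    (sum-*ˡ c (λ t → ∑ᵛ n λ x → g (t ∷ x)))

  ∑ᵛ-const : ∀ n c → ∑ᵛ n (λ _ → c) ≡ (+ p) ^ n * c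
  ∑ᵛ-const ℕ.zero    c = sym (ℤ.*-identityˡ c)
  ∑ᵛ-const (ℕ.suc n) c = trans (sum-cong-≗ {n = p} λ _ → ∑ᵛ-const n c)
    (trans (sum-const p ((+ p) ^ n * c)) (sym (ℤ.*-assoc (+ p) ((+ p) ^ n) c)))

  ∑ᵛ-++ : ∀ m {r} (g : 𝔽^ (m ℕ.+ r) → ℤ) → ∑ᵛ (m ℕ.+ r) g ≡ ∑ᵛ m λ a → ∑ᵛ r λ b → g (a ++ b)
  ∑ᵛ-++ ℕ.zero    g = refl
  ∑ᵛ-++ (ℕ.suc m) g = sum-cong-≗ λ t → ∑ᵛ-++ m λ x → g (t ∷ x)

  [[∷≟𝟎]] : ∀ {n} t (x : 𝔽^ n) → [[ t ∷ x ≟ᵛ 𝟎 ]] ≡ [[ t Fin.≟ 0ᶠ ]] * [[ x ≟ᵛ 𝟎 ]]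
  [[∷≟𝟎]] t x = trans ([[]]-cong (t ∷ x ≟ᵛ 𝟎) ((t Fin.≟ 0ᶠ) ×-dec (x ≟ᵛ 𝟎))
      Vec.∷-injective (λ { (refl , refl) → refl }))
    ([[]]-× (t Fin.≟ 0ᶠ) (x ≟ᵛ 𝟎))

  -- The indicator of the zero vector acts as a delta function.
  ∑ᵛ-δ : ∀ n (g : 𝔽^ n → ℤ) → ∑ᵛ n (λ x → [[ x ≟ᵛ 𝟎 ]] * g x) ≡ g 𝟎
  ∑ᵛ-δ ℕ.zero    g = trans (cong (_* g []) ([[]]-true ([] ≟ᵛ 𝟎) refl)) (ℤ.*-identityˡ (g []))
  ∑ᵛ-δ (ℕ.suc n) g = begin
    (sum λ t → ∑ᵛ n λ x → [[ t ∷ x ≟ᵛ 𝟎 ]] * g (t ∷ x))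
      ≡⟨ sum-cong-≗ (λ t → ∑ᵛ-cong n λ x → trans (cong (_* g (t ∷ x)) ([[∷≟𝟎]] t x))
           (ℤ.*-assoc [[ t Fin.≟ 0ᶠ ]] [[ x ≟ᵛ 𝟎 ]] (g (t ∷ x)))) ⟩
    (sum λ t → ∑ᵛ n λ x → [[ t Fin.≟ 0ᶠ ]] * ([[ x ≟ᵛ 𝟎 ]] * g (t ∷ x)))
      ≡⟨ sum-cong-≗ (λ t → trans (∑ᵛ-*ˡ n [[ t Fin.≟ 0ᶠ ]] (λ x → [[ x ≟ᵛ 𝟎 ]] * g (t ∷ x)))
           (cong ([[ t Fin.≟ 0ᶠ ]] *_) (∑ᵛ-δ n λ x → g (t ∷ x)))) ⟩
    (sum λ t → [[ t Fin.≟ 0ᶠ ]] * g (t ∷ 𝟎))   ≡⟨ sum-δ (λ t → g (t ∷ 𝟎)) ⟩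
    g 𝟎                                        ∎
    where open ≡-Reasoning

  -- The indicator of 𝔽 ∖ {0}.
  nz : 𝔽 → ℤ
  nz t = [[ ¬? (t Fin.≟ 0ᶠ) ]]

  sum-nz : (g : 𝔽 → ℤ) → sum (λ t → nz t * g t) ≡ sum g - g 0ᶠ
  sum-nz g = begin
    sum (λ t → nz t * g t)
      ≡⟨ sum-cong-≗ (λ t → trans (cong (_* g t) ([[]]-¬ (t Fin.≟ 0ᶠ)))
           (lemma [[ t Fin.≟ 0ᶠ ]] (g t))) ⟩
    sum (λ t → g t - [[ t Fin.≟ 0ᶠ ]] * g t)
      ≡⟨ sum-minus g (λ t → [[ t Fin.≟ 0ᶠ ]] * g t) ⟩
    sum g - sum (λ t → [[ t Fin.≟ 0ᶠ ]] * g t)   ≡⟨ cong (sum g -_) (sum-δ g) ⟩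
    sum g - g 0ᶠ                                 ∎
    where
    open ≡-Reasoning
    lemma : ∀ d g → (1ℤ - d) * g ≡ g - d * g
    lemma = solve-∀

  -- The number of nonzero elements of 𝔽.
  q : ℤ
  q = + p - 1ℤ

  sum-nz-const : ∀ c → sum (λ t → nz t * c) ≡ q * c
  sum-nz-const c = trans (sum-nz λ _ → c) (trans (cong (_- c) (sum-const p c)) (lemma (+ p) c))
    where
    lemma : ∀ p c → p * c - c ≡ (p - 1ℤ) * c
    lemma = solve-∀

  sum-nz≡q : sum nz ≡ q
  sum-nz≡q = trans (sum-cong-≗ λ t → sym (ℤ.*-identityʳ (nz t)))
    (trans (sum-nz-const 1ℤ) (ℤ.*-identityʳ q))

  -- An affine form with nonzero linear part takes every value equally often.
  ∑ᵛ-affine : ∀ n (u : 𝔽^ (ℕ.suc n)) → u ≢ 𝟎 → (g : 𝔽 → ℤ) → ∀ t →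
              ∑ᵛ (ℕ.suc n) (λ x → g (t +ᶠ u ∙ x)) ≡ (+ p) ^ n * sum g
  ∑ᵛ-affine n (c ∷ u) cu≢𝟎 g t with u ≟ᵛ 𝟎
  ... | yes refl = begin
    (sum λ y → ∑ᵛ n λ x → g (t +ᶠ (c *ᶠ y +ᶠ 𝟎 ∙ x)))
      ≡⟨ sum-cong-≗ (λ y → ∑ᵛ-cong n λ x → cong (λ z → g (t +ᶠ z))
           (trans (cong (c *ᶠ y +ᶠ_) (∙-zeroˡ x)) (+ᶠ-identityʳ (c *ᶠ y)))) ⟩
    (sum λ y → ∑ᵛ n λ x → g (t +ᶠ c *ᶠ y))
      ≡⟨ sum-cong-≗ (λ y → ∑ᵛ-const n (g (t +ᶠ c *ᶠ y))) ⟩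
    (sum λ y → (+ p) ^ n * g (t +ᶠ c *ᶠ y))    ≡⟨ sum-*ˡ ((+ p) ^ n) (λ y → g (t +ᶠ c *ᶠ y)) ⟩
    (+ p) ^ n * (sum λ y → g (t +ᶠ c *ᶠ y))
      ≡⟨ cong ((+ p) ^ n *_) (sum-affine t (λ c≡0 → cu≢𝟎 (cong (_∷ 𝟎) c≡0)) g) ⟩
    (+ p) ^ n * sum g                          ∎
    where open ≡-Reasoning
  ∑ᵛ-affine ℕ.zero    (c ∷ []) cu≢𝟎 g t | no u≢𝟎 = contradiction refl u≢𝟎
  ∑ᵛ-affine (ℕ.suc n) (c ∷ u)  cu≢𝟎 g t | no u≢𝟎 = begin
    (sum λ y → ∑ᵛ (ℕ.suc n) λ x → g (t +ᶠ (c *ᶠ y +ᶠ u ∙ x)))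
      ≡⟨ sum-cong-≗ (λ y → ∑ᵛ-cong (ℕ.suc n) λ x → cong g (sym (+ᶠ-assoc t (c *ᶠ y) (u ∙ x)))) ⟩
    (sum λ y → ∑ᵛ (ℕ.suc n) λ x → g (t +ᶠ c *ᶠ y +ᶠ u ∙ x))
      ≡⟨ sum-cong-≗ (λ y → ∑ᵛ-affine n u u≢𝟎 g (t +ᶠ c *ᶠ y)) ⟩
    (sum λ (y : 𝔽) → (+ p) ^ n * sum g)   ≡⟨ sum-const p ((+ p) ^ n * sum g) ⟩
    + p * ((+ p) ^ n * sum g)             ≡⟨ ℤ.*-assoc (+ p) ((+ p) ^ n) (sum g) ⟨
    (+ p) ^ ℕ.suc n * sum g               ∎
    where open ≡-Reasoning

  -- If D has total sum 0, only a constant form leaves a nonzero sum.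
  ∑ᵛ-mean-zero : ∀ {D : 𝔽 → ℤ} → sum D ≡ 0ℤ → ∀ m (v : 𝔽^ m) t →
                 ∑ᵛ m (λ a → D (t +ᶠ v ∙ a)) ≡ (+ p) ^ m * [[ v ≟ᵛ 𝟎 ]] * D t
  ∑ᵛ-mean-zero {D} ΣD≡0 m v t with v ≟ᵛ 𝟎
  ... | yes refl = begin
    ∑ᵛ m (λ a → D (t +ᶠ 𝟎 ∙ a))
      ≡⟨ ∑ᵛ-cong m (λ a → cong D (trans (cong (t +ᶠ_) (∙-zeroˡ a)) (+ᶠ-identityʳ t))) ⟩
    ∑ᵛ m (λ a → D t)           ≡⟨ ∑ᵛ-const m (D t) ⟩
    (+ p) ^ m * D t            ≡⟨ cong (_* D t) (ℤ.*-identityʳ ((+ p) ^ m)) ⟨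
    (+ p) ^ m * 1ℤ * D t       ∎
    where open ≡-Reasoning
  ∑ᵛ-mean-zero     ΣD≡0 ℕ.zero    [] t | no v≢𝟎 = contradiction refl v≢𝟎
  ∑ᵛ-mean-zero {D} ΣD≡0 (ℕ.suc m) v  t | no v≢𝟎 = begin
    ∑ᵛ (ℕ.suc m) (λ a → D (t +ᶠ v ∙ a))   ≡⟨ ∑ᵛ-affine m v v≢𝟎 D t ⟩
    (+ p) ^ m * sum D                     ≡⟨ cong ((+ p) ^ m *_) ΣD≡0 ⟩
    (+ p) ^ m * 0ℤ                        ≡⟨ lemma ((+ p) ^ m) (+ p) (D t) ⟩
    (+ p) ^ ℕ.suc m * 0ℤ * D t            ∎
    where
    open ≡-Reasoning
    lemma : ∀ x p d → x * 0ℤ ≡ p * x * 0ℤ * d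
    lemma = solve-∀

  allNonzero? : ∀ {n} → Decidable (All (_≢ 0ᶠ) {n})
  allNonzero? = All.all? λ t → ¬? (t Fin.≟ 0ᶠ)

  -- The integer indicator of the vectors without zero coordinate.
  full : ∀ {n} → 𝔽^ n → ℤ
  full a = [[ allNonzero? a ]]

  full-∷ : ∀ {n} t (a : 𝔽^ n) → full (t ∷ a) ≡ nz t * full a
  full-∷ t a = [[]]-× (¬? (t Fin.≟ 0ᶠ)) (allNonzero? a)

  ∑ᵛ-full : ∀ m → ∑ᵛ m full ≡ q ^ m
  ∑ᵛ-full ℕ.zero    = refl
  ∑ᵛ-full (ℕ.suc m) = begin
    (sum λ t → ∑ᵛ m λ a → full (t ∷ a))      ≡⟨ sum-cong-≗ (λ t → ∑ᵛ-cong m (full-∷ t)) ⟩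
    (sum λ t → ∑ᵛ m λ a → nz t * full a)
      ≡⟨ sum-cong-≗ (λ t → trans (∑ᵛ-*ˡ m (nz t) full) (cong (nz t *_) (∑ᵛ-full m))) ⟩
    (sum λ t → nz t * q ^ m)                 ≡⟨ sum-nz-const (q ^ m) ⟩
    q ^ ℕ.suc m                              ∎
    where open ≡-Reasoning

  -- Over the vectors without zero coordinate, a zero coordinate of v gives a
  -- factor q, the number of choices, and a nonzero one a factor -1, because the
  -- sum of D over all values but one is minus the missing value.
  ∑ᵛ-full-mean-zero : ∀ {D : 𝔽 → ℤ} → sum D ≡ 0ℤ → ∀ m (v : 𝔽^ m) t →
    ∑ᵛ m (λ a → full a * D (t +ᶠ v ∙ a)) ≡ -1ℤ ^ wt v * q ^ (m ∸ wt v) * D t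
  ∑ᵛ-full-mean-zero {D} ΣD≡0 ℕ.zero    []      t = trans (ℤ.*-identityˡ (D (t +ᶠ 0ᶠ)))
    (trans (cong D (+ᶠ-identityʳ t)) (sym (ℤ.*-identityˡ (D t))))
  ∑ᵛ-full-mean-zero {D} ΣD≡0 (ℕ.suc m) (c ∷ v) t = trans factor first-coordinate
    where
    open ≡-Reasoning
    k = wt v
    E = -1ℤ ^ k * q ^ (m ∸ k)
    -- The sum over all coordinates but the first, by induction.
    factor : ∑ᵛ (ℕ.suc m) (λ a → full a * D (t +ᶠ (c ∷ v) ∙ a)) ≡
             E * sum (λ y → nz y * D (t +ᶠ c *ᶠ y))
    factor = begin
      (sum λ y → ∑ᵛ m λ a → full (y ∷ a) * D (t +ᶠ (c *ᶠ y +ᶠ v ∙ a)))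
        ≡⟨ sum-cong-≗ (λ y → ∑ᵛ-cong m λ a → trans
             (cong₂ _*_ (full-∷ y a) (cong D (sym (+ᶠ-assoc t (c *ᶠ y) (v ∙ a)))))
             (ℤ.*-assoc (nz y) (full a) (D (t +ᶠ c *ᶠ y +ᶠ v ∙ a)))) ⟩
      (sum λ y → ∑ᵛ m λ a → nz y * (full a * D (t +ᶠ c *ᶠ y +ᶠ v ∙ a)))
        ≡⟨ sum-cong-≗ (λ y → trans (∑ᵛ-*ˡ m (nz y) (λ a → full a * D (t +ᶠ c *ᶠ y +ᶠ v ∙ a)))
             (trans (cong (nz y *_) (∑ᵛ-full-mean-zero ΣD≡0 m v (t +ᶠ c *ᶠ y)))
                    (lemma (nz y) E (D (t +ᶠ c *ᶠ y))))) ⟩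
      (sum λ y → E * (nz y * D (t +ᶠ c *ᶠ y)))   ≡⟨ sum-*ˡ E (λ y → nz y * D (t +ᶠ c *ᶠ y)) ⟩
      E * sum (λ y → nz y * D (t +ᶠ c *ᶠ y))     ∎
      where
      lemma : ∀ n e d → n * (e * d) ≡ e * (n * d)
      lemma = solve-∀
    first-coordinate : E * sum (λ y → nz y * D (t +ᶠ c *ᶠ y)) ≡
                      -1ℤ ^ wt (c ∷ v) * q ^ (ℕ.suc m ∸ wt (c ∷ v)) * D t
    first-coordinate with c Fin.≟ 0ᶠ
    ... | yes refl = begin
      E * sum (λ y → nz y * D (t +ᶠ 0ᶠ *ᶠ y))
        ≡⟨ cong (E *_) (sum-cong-≗ λ y → cong (λ z → nz y * D z)
             (trans (cong (t +ᶠ_) (*ᶠ-zeroˡ y)) (+ᶠ-identityʳ t))) ⟩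
      E * sum (λ y → nz y * D t)                   ≡⟨ cong (E *_) (sum-nz-const (D t)) ⟩
      E * (q * D t)                                ≡⟨ lemma (-1ℤ ^ k) (q ^ (m ∸ k)) q (D t) ⟩
      -1ℤ ^ k * q ^ ℕ.suc (m ∸ k) * D t
        ≡⟨ cong (λ e → -1ℤ ^ k * q ^ e * D t) (ℕ.+-∸-assoc 1 (Vec.count≤n _ v)) ⟨
      -1ℤ ^ k * q ^ (ℕ.suc m ∸ k) * D t            ∎
      where
      lemma : ∀ s x q d → s * x * (q * d) ≡ s * (q * x) * d
      lemma = solve-∀
    ... | no c≢0 = begin
      E * sum (λ y → nz y * D (t +ᶠ c *ᶠ y))
        ≡⟨ cong (E *_) (sum-nz λ y → D (t +ᶠ c *ᶠ y)) ⟩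
      E * (sum (λ y → D (t +ᶠ c *ᶠ y)) - D (t +ᶠ c *ᶠ 0ᶠ))
        ≡⟨ cong₂ (λ x y → E * (x - y)) (trans (sum-affine t c≢0 D) ΣD≡0)
             (cong D (trans (cong (t +ᶠ_) (*ᶠ-zeroʳ c)) (+ᶠ-identityʳ t))) ⟩
      E * (0ℤ - D t)                               ≡⟨ lemma (-1ℤ ^ k) (q ^ (m ∸ k)) (D t) ⟩
      -1ℤ ^ ℕ.suc k * q ^ (m ∸ k) * D t            ∎
      where
      lemma : ∀ s x d → s * x * (0ℤ - d) ≡ -1ℤ * s * x * d
      lemma = solve-∀

  ∑-nonzeroVectors : ∀ n (g : 𝔽^ n → ℤ) → ∑ˡ (nonzeroVectors n) g ≡ ∑ᵛ n g - g 𝟎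
  ∑-nonzeroVectors n g = begin
    ∑ˡ (nonzeroVectors n) g
      ≡⟨ ∑ˡ-filter (λ x → ¬? (x ≟ᵛ 𝟎)) (allVectors n) g ⟩
    ∑ˡ (allVectors n) (λ x → [[ ¬? (x ≟ᵛ 𝟎) ]] * g x)
      ≡⟨ ∑ˡ-allVectors n (λ x → [[ ¬? (x ≟ᵛ 𝟎) ]] * g x) ⟩
    ∑ᵛ n (λ x → [[ ¬? (x ≟ᵛ 𝟎) ]] * g x)
      ≡⟨ ∑ᵛ-cong n (λ x → trans (cong (_* g x) ([[]]-¬ (x ≟ᵛ 𝟎))) (lemma [[ x ≟ᵛ 𝟎 ]] (g x))) ⟩
    ∑ᵛ n (λ x → g x - [[ x ≟ᵛ 𝟎 ]] * g x)           ≡⟨ ∑ᵛ-minus n g (λ x → [[ x ≟ᵛ 𝟎 ]] * g x) ⟩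
    ∑ᵛ n g - ∑ᵛ n (λ x → [[ x ≟ᵛ 𝟎 ]] * g x)        ≡⟨ cong (∑ᵛ n g -_) (∑ᵛ-δ n g) ⟩
    ∑ᵛ n g - g 𝟎                                    ∎
    where
    open ≡-Reasoning
    lemma : ∀ d g → (1ℤ - d) * g ≡ g - d * g
    lemma = solve-∀

  card≡∑ : ∀ {n} {P : Pred (𝔽^ n) ℓ} (P? : Decidable P) → + card P? ≡ ∑ᵛ n (λ x → [[ P? x ]])
  card≡∑ {n = n} P? = begin
    + card P?                                      ≡⟨ length≡∑ˡ (filter P? (allVectors n)) ⟩
    ∑ˡ (filter P? (allVectors n)) (λ _ → 1ℤ)       ≡⟨ ∑ˡ-filter P? (allVectors n) (λ _ → 1ℤ) ⟩
    ∑ˡ (allVectors n) (λ x → [[ P? x ]] * 1ℤ)      ≡⟨ ∑ˡ-allVectors n (λ x → [[ P? x ]] * 1ℤ) ⟩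
    ∑ᵛ n (λ x → [[ P? x ]] * 1ℤ)
      ≡⟨ ∑ᵛ-cong n (λ x → ℤ.*-identityʳ [[ P? x ]]) ⟩
    ∑ᵛ n (λ x → [[ P? x ]])                        ∎
    where open ≡-Reasoning

  wt-map : (h : A → 𝔽) (xs : List A) → + wt (Vec.map h (fromList xs)) ≡ ∑ˡ xs (λ x → nz (h x))
  wt-map h []       = refl
  wt-map h (x ∷ xs) with h x Fin.≟ 0ᶠ
  ... | yes _ = trans (wt-map h xs) (sym (ℤ.+-identityˡ _))
  ... | no  _ = cong (_+_ 1ℤ) (wt-map h xs)

  nz-0 : nz 0ᶠ ≡ 0ℤ
  nz-0 = [[]]-false (¬? (0ᶠ Fin.≟ 0ᶠ)) λ 0≢0 → 0≢0 refl

  length-nonzeroVectors : ∀ n → + length (nonzeroVectors n) ≡ (+ p) ^ n - 1ℤ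
  length-nonzeroVectors n = trans (length≡∑ˡ (nonzeroVectors n))
    (trans (∑-nonzeroVectors n (λ _ → 1ℤ))
      (cong (_- 1ℤ) (trans (∑ᵛ-const n 1ℤ) (ℤ.*-identityʳ ((+ p) ^ n)))))

  -- When f vanishes at 0, the point 0 may be added to the coordinates without
  -- changing the weight, since every codeword would be 0 there.
  wt-codeword : ∀ {n} (f : 𝔽^ n → 𝔽) → f 𝟎 ≡ 0ᶠ → ∀ s u →
    + wt (codeword f s u) ≡ ∑ᵛ n (λ x → nz (s *ᶠ f x +ᶠ u ∙ x))
  wt-codeword {n} f f0≡0 s u = begin
    + wt (codeword f s u)                          ≡⟨ wt-map h (nonzeroVectors n) ⟩
    ∑ˡ (nonzeroVectors n) (λ x → nz (h x))         ≡⟨ ∑-nonzeroVectors n (λ x → nz (h x)) ⟩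
    ∑ᵛ n (λ x → nz (h x)) - nz (h 𝟎)
      ≡⟨ cong (λ z → ∑ᵛ n (λ x → nz (h x)) - nz z) h0≡0 ⟩
    ∑ᵛ n (λ x → nz (h x)) - nz 0ᶠ                  ≡⟨ cong (∑ᵛ n (λ x → nz (h x)) -_) nz-0 ⟩
    ∑ᵛ n (λ x → nz (h x)) - 0ℤ                     ≡⟨ ℤ.+-identityʳ _ ⟩
    ∑ᵛ n (λ x → nz (h x))                          ∎
    where
    open ≡-Reasoning
    h : 𝔽^ n → 𝔽
    h x = s *ᶠ f x +ᶠ u ∙ x
    h0≡0 : h 𝟎 ≡ 0ᶠ
    h0≡0 = trans (cong₂ _+ᶠ_ (trans (cong (s *ᶠ_) f0≡0) (*ᶠ-zeroʳ s)) (∙-zeroʳ u)) (+ᶠ-identityˡ 0ᶠ)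

-- The ideals of ℍ m n and the code that they define

-- The hypothesis I-top says that every element has multiplicity p - 1 in I, so
-- that I contains all multisets.
module IdealCode (p : ℕ) .{{_ : NonZero p}} (p-prime : Prime p) (p-odd : 2 ∤ p)
                 (m r : ℕ) (I : Codes.𝔽^_ p (m ℕ.+ r))
                 (I-top : ∀ i → toℕ (lookup I i) ≡ p ∸ 1) where

  open Codes p
  open PrimeField p p-prime p-odd
  open VectorSums p p-prime p-odd

  n : ℕ
  n = m ℕ.+ r

  -- The function that defines the code.
  f : 𝔽^ n → 𝔽
  f = characteristic (nonzeroIdealsIn? m I)

  ⊆ₘ-top : ∀ {k} (J J′ : 𝔽^ k) → (∀ i → toℕ (lookup J′ i) ≡ p ∸ 1) → J ⊆ₘ J′
  ⊆ₘ-top []      []        eq = []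
  ⊆ₘ-top (x ∷ J) (x′ ∷ J′) eq =
    subst (toℕ x ≤_) (sym (eq zero)) (Fin.toℕ≤pred[n] x) ∷ ⊆ₘ-top J J′ (eq ∘ suc)

  -- An ideal with an element in the upper level contains the whole lower level.
  ideal⇒ : ∀ (a : 𝔽^ m) (b : 𝔽^ r) → IdealsIn m I (a ++ b) → b ≢ 𝟎 → All (_≢ 0ᶠ) a
  ideal⇒ a b (isIdeal , _) b≢𝟎 with ≢𝟎⇒∃≢0 b b≢𝟎
  ... | j , bⱼ≢0 = All.lookup⁻ λ i aᵢ≡0 →
    isIdeal (i ↑ˡ r) (m ↑ʳ j) (inj₁ (i<m i , m≤j))
      (λ eq → bⱼ≢0 (trans (sym (Vec.lookup-++ʳ a b j)) eq))
      (trans (Vec.lookup-++ˡ a b i) aᵢ≡0)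
    where
    i<m : ∀ i → toℕ (i ↑ˡ r) ℕ.< m
    i<m i = subst (ℕ._< m) (sym (Fin.toℕ-↑ˡ i r)) (Fin.toℕ<n i)
    m≤j : m ≤ toℕ (m ↑ʳ j)
    m≤j = subst (m ≤_) (sym (Fin.toℕ-↑ʳ m j)) (ℕ.m≤m+n m (toℕ j))

  ⇒ideal : ∀ (a : 𝔽^ m) (b : 𝔽^ r) → (b ≢ 𝟎 → All (_≢ 0ᶠ) a) → IdealsIn m I (a ++ b)
  ⇒ideal a b H = isIdeal , ⊆ₘ-top (a ++ b) I I-top
    where
    isIdeal : IsUnsaturatedIdeal m (a ++ b)
    isIdeal i .i (inj₂ refl)        i∈ = i∈
    isIdeal i j  (inj₁ (i<m , m≤j)) j∈ aᵢ≡0 =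
      All.lookup⁺ (H b≢𝟎) (Fin.fromℕ< i<m) (trans (sym (Vec.lookup-++-< a b i i<m)) aᵢ≡0)
      where
      b≢𝟎 : b ≢ 𝟎
      b≢𝟎 refl = j∈ (trans (Vec.lookup-++-≥ a b j m≤j) (Vec.lookup-replicate (Fin.reduce≥ j m≤j) 0ᶠ))

  -- The indicator of I(𝔾ℙ).
  ideal : 𝔽^ n → ℤ
  ideal x = [[ idealsIn? m I x ]]

  ideal-++ : ∀ (a : 𝔽^ m) (b : 𝔽^ r) →
             ideal (a ++ b) ≡ [[ b ≟ᵛ 𝟎 ]] + full a * (1ℤ - [[ b ≟ᵛ 𝟎 ]])
  ideal-++ a b = by-cases (b ≟ᵛ 𝟎) (allNonzero? a)
    where
    by-cases : (d : Dec (b ≡ 𝟎)) (e : Dec (All (_≢ 0ᶠ) a)) →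
               ideal (a ++ b) ≡ [[ d ]] + [[ e ]] * (1ℤ - [[ d ]])
    by-cases (yes b≡𝟎) e        = trans
      ([[]]-true (idealsIn? m I (a ++ b)) (⇒ideal a b λ b≢𝟎 → contradiction b≡𝟎 b≢𝟎))
      (sym (trans (cong (_+_ 1ℤ) (ℤ.*-zeroʳ [[ e ]])) (ℤ.+-identityʳ 1ℤ)))
    by-cases (no b≢𝟎)  (yes a∈) = [[]]-true (idealsIn? m I (a ++ b)) (⇒ideal a b λ _ → a∈)
    by-cases (no b≢𝟎)  (no a∉)  = [[]]-false (idealsIn? m I (a ++ b)) λ x → a∉ (ideal⇒ a b x b≢𝟎)

  ideal-𝟎 : ideal 𝟎 ≡ 1ℤ
  ideal-𝟎 = [[]]-true (idealsIn? m I 𝟎) (subst (IdealsIn m I) (𝟎-++ m r)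
    (⇒ideal 𝟎 𝟎 λ 𝟎≢𝟎 → contradiction refl 𝟎≢𝟎))

  -- Summation over I(𝔾ℙ) = (𝔽^m × 0) ∪ ((𝔽 ∖ 0)^m × (𝔽^r ∖ 0)): the fibre over
  -- a always contains (a,0), and the other (a,b) exactly when a has no zero
  -- coordinate.
  ∑-ideal : (h : 𝔽^ n → ℤ) → ∑ᵛ n (λ x → ideal x * h x) ≡
            ∑ᵛ m λ a → h (a ++ 𝟎) + full a * ((∑ᵛ r λ b → h (a ++ b)) - h (a ++ 𝟎))
  ∑-ideal h = trans (∑ᵛ-++ m (λ x → ideal x * h x)) (∑ᵛ-cong m fibre)
    where
    open ≡-Reasoning
    split : ∀ d F h → (d + F * (1ℤ - d)) * h ≡ d * h + F * (h - d * h)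
    split = solve-∀
    fibre : ∀ a → ∑ᵛ r (λ b → ideal (a ++ b) * h (a ++ b)) ≡
                  h (a ++ 𝟎) + full a * ((∑ᵛ r λ b → h (a ++ b)) - h (a ++ 𝟎))
    fibre a = begin
      ∑ᵛ r (λ b → ideal (a ++ b) * h (a ++ b))
        ≡⟨ ∑ᵛ-cong r (λ b → trans (cong (_* h (a ++ b)) (ideal-++ a b))
             (split [[ b ≟ᵛ 𝟎 ]] (full a) (h (a ++ b)))) ⟩
      ∑ᵛ r (λ b → δh b + full a * (h (a ++ b) - δh b))
        ≡⟨ ∑ᵛ-+ r δh (λ b → full a * (h (a ++ b) - δh b)) ⟩
      ∑ᵛ r δh + ∑ᵛ r (λ b → full a * (h (a ++ b) - δh b))
        ≡⟨ cong (_+_ (∑ᵛ r δh)) (trans (∑ᵛ-*ˡ r (full a) (λ b → h (a ++ b) - δh b))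
             (cong (full a *_) (∑ᵛ-minus r (λ b → h (a ++ b)) δh))) ⟩
      ∑ᵛ r δh + full a * ((∑ᵛ r λ b → h (a ++ b)) - ∑ᵛ r δh)
        ≡⟨ cong (λ z → z + full a * ((∑ᵛ r λ b → h (a ++ b)) - z)) (∑ᵛ-δ r (λ b → h (a ++ b))) ⟩
      h (a ++ 𝟎) + full a * ((∑ᵛ r λ b → h (a ++ b)) - h (a ++ 𝟎))  ∎
      where
      δh : 𝔽^ r → ℤ
      δh b = [[ b ≟ᵛ 𝟎 ]] * h (a ++ b)

  card-ideals : + card (idealsIn? m I) ≡ (+ p) ^ m + q ^ m * ((+ p) ^ r - 1ℤ)
  card-ideals = begin
    + card (idealsIn? m I)                          ≡⟨ card≡∑ (idealsIn? m I) ⟩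
    ∑ᵛ n ideal
      ≡⟨ ∑ᵛ-cong n (λ x → ℤ.*-identityʳ (ideal x)) ⟨
    ∑ᵛ n (λ x → ideal x * 1ℤ)                       ≡⟨ ∑-ideal (λ _ → 1ℤ) ⟩
    ∑ᵛ m (λ a → 1ℤ + full a * (∑ᵛ r (λ _ → 1ℤ) - 1ℤ))
      ≡⟨ ∑ᵛ-cong m (λ a → cong (_+_ 1ℤ) (trans
           (cong (λ z → full a * (z - 1ℤ)) (trans (∑ᵛ-const r 1ℤ) (ℤ.*-identityʳ ((+ p) ^ r))))
           (ℤ.*-comm (full a) pʳ-1))) ⟩
    ∑ᵛ m (λ a → 1ℤ + pʳ-1 * full a)                 ≡⟨ ∑ᵛ-+ m (λ _ → 1ℤ) (λ a → pʳ-1 * full a) ⟩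
    ∑ᵛ m (λ _ → 1ℤ) + ∑ᵛ m (λ a → pʳ-1 * full a)
      ≡⟨ cong₂ _+_ (trans (∑ᵛ-const m 1ℤ) (ℤ.*-identityʳ ((+ p) ^ m)))
           (trans (∑ᵛ-*ˡ m pʳ-1 full) (trans (cong (pʳ-1 *_) (∑ᵛ-full m)) (ℤ.*-comm pʳ-1 (q ^ m)))) ⟩
    (+ p) ^ m + q ^ m * pʳ-1                        ∎
    where
    open ≡-Reasoning
    pʳ-1 = (+ p) ^ r - 1ℤ

  -- The integer-valued counterpart of f.
  F : 𝔽^ n → ℤ
  F x = [[ nonzeroIdealsIn? m I x ]]

  ∑-F : (h : 𝔽^ n → ℤ) → ∑ᵛ n (λ x → F x * h x) ≡ ∑ᵛ n (λ x → ideal x * h x) - h 𝟎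
  ∑-F h = begin
    ∑ᵛ n (λ x → F x * h x)
      ≡⟨ ∑ᵛ-cong n (λ x → trans (cong (_* h x) (trans ([[]]-× (idealsIn? m I x) (¬? (x ≟ᵛ 𝟎)))
           (cong (ideal x *_) ([[]]-¬ (x ≟ᵛ 𝟎))))) (split (ideal x) [[ x ≟ᵛ 𝟎 ]] (h x))) ⟩
    ∑ᵛ n (λ x → ideal x * h x - [[ x ≟ᵛ 𝟎 ]] * (ideal x * h x))
      ≡⟨ ∑ᵛ-minus n (λ x → ideal x * h x) (λ x → [[ x ≟ᵛ 𝟎 ]] * (ideal x * h x)) ⟩
    ∑ᵛ n (λ x → ideal x * h x) - ∑ᵛ n (λ x → [[ x ≟ᵛ 𝟎 ]] * (ideal x * h x))
      ≡⟨ cong (∑ᵛ n (λ x → ideal x * h x) -_) (∑ᵛ-δ n (λ x → ideal x * h x)) ⟩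
    ∑ᵛ n (λ x → ideal x * h x) - ideal 𝟎 * h 𝟎
      ≡⟨ cong (∑ᵛ n (λ x → ideal x * h x) -_) (trans (cong (_* h 𝟎) ideal-𝟎) (ℤ.*-identityˡ (h 𝟎))) ⟩
    ∑ᵛ n (λ x → ideal x * h x) - h 𝟎   ∎
    where
    open ≡-Reasoning
    split : ∀ i d h → i * (1ℤ - d) * h ≡ i * h - d * (i * h)
    split = solve-∀

  f-true : ∀ x → IdealsIn m I x → x ≢ 𝟎 → f x ≡ 1ᶠ
  f-true x x∈I x≢𝟎 rewrite dec-true (nonzeroIdealsIn? m I x) (x∈I , x≢𝟎) = refl

  f-false : ∀ x → ¬ (IdealsIn m I x × x ≢ 𝟎) → f x ≡ 0ᶠ
  f-false x x∉ rewrite dec-false (nonzeroIdealsIn? m I x) x∉ = refl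

  f-𝟎 : f 𝟎 ≡ 0ᶠ
  f-𝟎 = f-false 𝟎 λ (_ , 𝟎≢𝟎) → 𝟎≢𝟎 refl

  -- Weights

  wt-0-u : ∀ u → u ≢ 𝟎 → + wt (codeword f 0ᶠ u) ≡ q * (+ p) ^ (n ∸ 1)
  wt-0-u u u≢𝟎 = trans (wt-codeword f f-𝟎 0ᶠ u)
    (trans (∑ᵛ-cong n λ x → cong (λ z → nz (z +ᶠ u ∙ x)) (*ᶠ-zeroˡ (f x))) (∑-nz-form n u u≢𝟎))
    where
    ∑-nz-form : ∀ n (u : 𝔽^ n) → u ≢ 𝟎 → ∑ᵛ n (λ x → nz (0ᶠ +ᶠ u ∙ x)) ≡ q * (+ p) ^ (n ∸ 1)
    ∑-nz-form ℕ.zero    []  u≢𝟎 = contradiction refl u≢𝟎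
    ∑-nz-form (ℕ.suc n) u   u≢𝟎 = trans (∑ᵛ-affine n u u≢𝟎 nz 0ᶠ)
      (trans (cong ((+ p) ^ n *_) sum-nz≡q) (ℤ.*-comm ((+ p) ^ n) q))

  nz-true : ∀ {t} → t ≢ 0ᶠ → nz t ≡ 1ℤ
  nz-true {t} = [[]]-true (¬? (t Fin.≟ 0ᶠ))

  wt-s-𝟎 : ∀ s → s ≢ 0ᶠ → + wt (codeword f s 𝟎) ≡ + card (idealsIn? m I) - 1ℤ
  wt-s-𝟎 s s≢0 = begin
    + wt (codeword f s 𝟎)                     ≡⟨ wt-codeword f f-𝟎 s 𝟎 ⟩
    ∑ᵛ n (λ x → nz (s *ᶠ f x +ᶠ 𝟎 ∙ x))       ≡⟨ ∑ᵛ-cong n pointwise ⟩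
    ∑ᵛ n (λ x → F x * 1ℤ)                     ≡⟨ ∑-F (λ _ → 1ℤ) ⟩
    ∑ᵛ n (λ x → ideal x * 1ℤ) - 1ℤ
      ≡⟨ cong (_- 1ℤ) (∑ᵛ-cong n λ x → ℤ.*-identityʳ (ideal x)) ⟩
    ∑ᵛ n ideal - 1ℤ                           ≡⟨ cong (_- 1ℤ) (card≡∑ (idealsIn? m I)) ⟨
    + card (idealsIn? m I) - 1ℤ               ∎
    where
    open ≡-Reasoning
    pointwise : ∀ x → nz (s *ᶠ f x +ᶠ 𝟎 ∙ x) ≡ F x * 1ℤ
    pointwise x = trans
      (cong nz (trans (cong (s *ᶠ f x +ᶠ_) (∙-zeroˡ x)) (+ᶠ-identityʳ (s *ᶠ f x)))) by-value
      where
      by-value : nz (s *ᶠ f x) ≡ F x * 1ℤ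
      by-value with does (nonzeroIdealsIn? m I x)
      ... | true  = trans (cong nz (*ᶠ-identityʳ s)) (nz-true s≢0)
      ... | false = trans (cong nz (*ᶠ-zeroʳ s)) nz-0

  module _ (s : 𝔽) (s≢0 : s ≢ 0ᶠ) where

    -- The change in N(t) = [t ≠ 0] when the value t is shifted by s.
    D : 𝔽 → ℤ
    D t = nz (s +ᶠ t) - nz t

    D-0 : D 0ᶠ ≡ 1ℤ
    D-0 = cong₂ _-_ (trans (cong nz (+ᶠ-identityʳ s)) (nz-true s≢0)) nz-0

    ∑D≡0 : sum D ≡ 0ℤ
    ∑D≡0 = begin
      sum D                                         ≡⟨ sum-minus (λ t → nz (s +ᶠ t)) nz ⟩
      sum (λ t → nz (s +ᶠ t)) - sum nz
        ≡⟨ cong (_- sum nz) (sum-cong-≗ λ t → cong (λ z → nz (s +ᶠ z)) (*ᶠ-identityˡ t)) ⟨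
      sum (λ t → nz (s +ᶠ 1ᶠ *ᶠ t)) - sum nz        ≡⟨ cong (_- sum nz) (sum-affine s 1ᶠ≢0 nz) ⟩
      sum nz - sum nz                               ≡⟨ ℤ.+-inverseʳ (sum nz) ⟩
      0ℤ                                            ∎
      where open ≡-Reasoning

    ∑-ideal-D : ∀ (v : 𝔽^ m) (w : 𝔽^ r) →
      ∑ᵛ n (λ x → ideal x * D ((v ++ w) ∙ x)) ≡
      (+ p) ^ m * [[ v ≟ᵛ 𝟎 ]] + -1ℤ ^ wt v * q ^ (m ∸ wt v) * ((+ p) ^ r * [[ w ≟ᵛ 𝟎 ]] - 1ℤ)
    ∑-ideal-D v w = begin
      ∑ᵛ n (λ x → ideal x * D ((v ++ w) ∙ x))
        ≡⟨ ∑-ideal (λ x → D ((v ++ w) ∙ x)) ⟩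
      ∑ᵛ m (λ a → D ((v ++ w) ∙ (a ++ 𝟎))
            + full a * (∑ᵛ r (λ b → D ((v ++ w) ∙ (a ++ b))) - D ((v ++ w) ∙ (a ++ 𝟎))))
        ≡⟨ ∑ᵛ-cong m (λ a → cong₂ (λ x y → x + full a * (y - x)) (on-a a) (on-fibre a)) ⟩
      ∑ᵛ m (λ a → Dv a + full a * (R * Dv a - Dv a))
        ≡⟨ ∑ᵛ-cong m (λ a → collect (Dv a) (full a) R) ⟩
      ∑ᵛ m (λ a → Dv a + (R - 1ℤ) * (full a * Dv a))
        ≡⟨ ∑ᵛ-+ m Dv (λ a → (R - 1ℤ) * (full a * Dv a)) ⟩
      ∑ᵛ m Dv + ∑ᵛ m (λ a → (R - 1ℤ) * (full a * Dv a))
        ≡⟨ cong₂ _+_ (∑ᵛ-mean-zero ∑D≡0 m v 0ᶠ)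
             (trans (∑ᵛ-*ˡ m (R - 1ℤ) (λ a → full a * Dv a))
               (cong ((R - 1ℤ) *_) (∑ᵛ-full-mean-zero ∑D≡0 m v 0ᶠ))) ⟩
      M * D 0ᶠ + (R - 1ℤ) * (E * D 0ᶠ)
        ≡⟨ cong (λ z → M * z + (R - 1ℤ) * (E * z)) D-0 ⟩
      M * 1ℤ + (R - 1ℤ) * (E * 1ℤ)                ≡⟨ simplify M R E ⟩
      M + E * (R - 1ℤ)                            ∎
      where
      open ≡-Reasoning
      M = (+ p) ^ m * [[ v ≟ᵛ 𝟎 ]]
      R = (+ p) ^ r * [[ w ≟ᵛ 𝟎 ]]
      E = -1ℤ ^ wt v * q ^ (m ∸ wt v)
      Dv : 𝔽^ m → ℤ
      Dv a = D (0ᶠ +ᶠ v ∙ a)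
      collect : ∀ x F R → x + F * (R * x - x) ≡ x + (R - 1ℤ) * (F * x)
      collect = solve-∀
      simplify : ∀ M R E → M * 1ℤ + (R - 1ℤ) * (E * 1ℤ) ≡ M + E * (R - 1ℤ)
      simplify = solve-∀
      on-a : ∀ a → D ((v ++ w) ∙ (a ++ 𝟎)) ≡ Dv a
      on-a a = cong D (trans (∙-++𝟎 v a w) (sym (+ᶠ-identityˡ (v ∙ a))))
      on-fibre : ∀ a → ∑ᵛ r (λ b → D ((v ++ w) ∙ (a ++ b))) ≡ R * Dv a
      on-fibre a = trans (∑ᵛ-cong r λ b → cong D (∙-++ v a w b))
        (trans (∑ᵛ-mean-zero ∑D≡0 r w (v ∙ a))
          (cong (λ z → R * D z) (sym (+ᶠ-identityˡ (v ∙ a)))))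

    wt-s-u : ∀ (v : 𝔽^ m) (w : 𝔽^ r) → v ++ w ≢ 𝟎 → + wt (codeword f s (v ++ w)) ≡
      q * (+ p) ^ (n ∸ 1) - 1ℤ + (+ p) ^ m * [[ v ≟ᵛ 𝟎 ]]
        + -1ℤ ^ wt v * q ^ (m ∸ wt v) * ((+ p) ^ r * [[ w ≟ᵛ 𝟎 ]] - 1ℤ)
    wt-s-u v w vw≢𝟎 = begin
      + wt (codeword f s u)                              ≡⟨ wt-codeword f f-𝟎 s u ⟩
      ∑ᵛ n (λ x → nz (s *ᶠ f x +ᶠ u ∙ x))                ≡⟨ ∑ᵛ-cong n pointwise ⟩
      ∑ᵛ n (λ x → nz (0ᶠ *ᶠ f x +ᶠ u ∙ x) + F x * D (u ∙ x))
        ≡⟨ ∑ᵛ-+ n (λ x → nz (0ᶠ *ᶠ f x +ᶠ u ∙ x)) (λ x → F x * D (u ∙ x)) ⟩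
      ∑ᵛ n (λ x → nz (0ᶠ *ᶠ f x +ᶠ u ∙ x)) + ∑ᵛ n (λ x → F x * D (u ∙ x))
        ≡⟨ cong₂ _+_ (trans (sym (wt-codeword f f-𝟎 0ᶠ u)) (wt-0-u u vw≢𝟎)) (∑-F (λ x → D (u ∙ x))) ⟩
      Q + (∑ᵛ n (λ x → ideal x * D (u ∙ x)) - D (u ∙ 𝟎))
        ≡⟨ cong₂ (λ x y → Q + (x - y)) (∑-ideal-D v w) (trans (cong D (∙-zeroʳ u)) D-0) ⟩
      Q + (M + E - 1ℤ)                                   ≡⟨ rearrange Q M E ⟩
      Q - 1ℤ + M + E                                     ∎
      where
      open ≡-Reasoning
      u = v ++ w
      Q = q * (+ p) ^ (n ∸ 1)
      M = (+ p) ^ m * [[ v ≟ᵛ 𝟎 ]]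
      E = -1ℤ ^ wt v * q ^ (m ∸ wt v) * ((+ p) ^ r * [[ w ≟ᵛ 𝟎 ]] - 1ℤ)
      rearrange : ∀ Q M E → Q + (M + E - 1ℤ) ≡ Q - 1ℤ + M + E
      rearrange = solve-∀
      pointwise : ∀ x → nz (s *ᶠ f x +ᶠ u ∙ x) ≡ nz (0ᶠ *ᶠ f x +ᶠ u ∙ x) + F x * D (u ∙ x)
      pointwise x = trans by-value (cong (λ z → nz z + F x * D (u ∙ x))
          (sym (trans (cong (_+ᶠ u ∙ x) (*ᶠ-zeroˡ (f x))) (+ᶠ-identityˡ (u ∙ x)))))
        where
        cancel : ∀ y z → y ≡ z + 1ℤ * (y - z)
        cancel = solve-∀
        vanish : ∀ z d → z ≡ z + 0ℤ * d
        vanish = solve-∀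
        by-value : nz (s *ᶠ f x +ᶠ u ∙ x) ≡ nz (u ∙ x) + F x * D (u ∙ x)
        by-value with does (nonzeroIdealsIn? m I x)
        ... | true  = trans (cong (λ z → nz (z +ᶠ u ∙ x)) (*ᶠ-identityʳ s))
                            (cancel (nz (s +ᶠ u ∙ x)) (nz (u ∙ x)))
        ... | false = trans (cong nz (trans (cong (_+ᶠ u ∙ x) (*ᶠ-zeroʳ s)) (+ᶠ-identityˡ (u ∙ x))))
                            (vanish (nz (u ∙ x)) (D (u ∙ x)))

  -- Zero sets of codewords

  -ᶠ≢0 : ∀ {s} → s ≢ 0ᶠ → -ᶠ s ≢ 0ᶠ
  -ᶠ≢0 {s} s≢0 -s≡0 = s≢0 (trans (sym (+ᶠ-identityˡ s))
    (trans (cong (_+ᶠ s) (sym -s≡0)) (+ᶠ-inverseˡ s)))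

  ++≡𝟎⇒ : ∀ (a : 𝔽^ m) (b : 𝔽^ r) → a ++ b ≡ 𝟎 → a ≡ 𝟎 × b ≡ 𝟎
  ++≡𝟎⇒ a b eq = Vec.++-injective a 𝟎 (trans eq (sym (𝟎-++ m r)))

  -- The coordinate at x of the codeword c(s,u), extended to x = 0.  It is the
  -- inner product of (s,u) with (f(x),x), hence linear in (s,u).
  value : 𝔽 → 𝔽^ n → 𝔽^ n → 𝔽
  value s u x = s *ᶠ f x +ᶠ u ∙ x

  value-𝟎 : ∀ s u → value s u 𝟎 ≡ 0ᶠ
  value-𝟎 s u = trans
    (cong₂ _+ᶠ_ (trans (cong (s *ᶠ_) f-𝟎) (*ᶠ-zeroʳ s)) (∙-zeroʳ u)) (+ᶠ-identityˡ 0ᶠ)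

  value-true : ∀ s u {x} → f x ≡ 1ᶠ → value s u x ≡ s +ᶠ u ∙ x
  value-true s u {x} fx≡1 =
    cong (_+ᶠ u ∙ x) (trans (cong (s *ᶠ_) fx≡1) (*ᶠ-identityʳ s))

  value-false : ∀ s u {x} → f x ≡ 0ᶠ → value s u x ≡ u ∙ x
  value-false s u {x} fx≡0 = trans
    (cong (_+ᶠ u ∙ x) (trans (cong (s *ᶠ_) fx≡0) (*ᶠ-zeroʳ s))) (+ᶠ-identityˡ (u ∙ x))

  f-a𝟎 : ∀ a → a ≢ 𝟎 → f (a ++ 𝟎) ≡ 1ᶠ
  f-a𝟎 a a≢𝟎 = f-true (a ++ 𝟎) (⇒ideal a 𝟎 λ 𝟎≢𝟎 → contradiction refl 𝟎≢𝟎)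
    (a≢𝟎 ∘ proj₁ ∘ ++≡𝟎⇒ a 𝟎)

  f-full : ∀ a b → All (_≢ 0ᶠ) a → b ≢ 𝟎 → f (a ++ b) ≡ 1ᶠ
  f-full a b a∈ b≢𝟎 = f-true (a ++ b) (⇒ideal a b λ _ → a∈) (b≢𝟎 ∘ proj₂ ∘ ++≡𝟎⇒ a b)

  f-outside : ∀ a b → ¬ All (_≢ 0ᶠ) a → b ≢ 𝟎 → f (a ++ b) ≡ 0ᶠ
  f-outside a b a∉ b≢𝟎 = f-false (a ++ b) λ (x∈I , _) → a∉ (ideal⇒ a b x∈I b≢𝟎)

  -- A linear form in at least two variables has a nonzero zero.
  orthogonal : ∀ {k} → 2 ≤ k → (v : 𝔽^ k) → ∃ λ a → a ≢ 𝟎 × v ∙ a ≡ 0ᶠ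
  orthogonal (ℕ.s≤s (ℕ.s≤s _)) v@(v₀ ∷ v₁ ∷ v′) with v₀ Fin.≟ 0ᶠ
  ... | yes refl = single zero 1ᶠ , (λ eq → 1ᶠ≢0 (Vec.∷-injectiveˡ eq)) ,
                   trans (∙-single v zero 1ᶠ) (*ᶠ-zeroˡ 1ᶠ)
  ... | no v₀≢0  = v₁ ∷ (-ᶠ v₀) ∷ 𝟎 ,
                   (λ eq → -ᶠ≢0 v₀≢0 (Vec.∷-injectiveˡ (Vec.∷-injectiveʳ eq))) , (begin
    v₀ *ᶠ v₁ +ᶠ (v₁ *ᶠ (-ᶠ v₀) +ᶠ v′ ∙ 𝟎)
      ≡⟨ cong (v₀ *ᶠ v₁ +ᶠ_) (trans (cong (v₁ *ᶠ (-ᶠ v₀) +ᶠ_) (∙-zeroʳ v′))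
           (+ᶠ-identityʳ (v₁ *ᶠ (-ᶠ v₀)))) ⟩
    v₀ *ᶠ v₁ +ᶠ v₁ *ᶠ (-ᶠ v₀)         ≡⟨ cong (v₀ *ᶠ v₁ +ᶠ_) (-ᶠ-distribʳ-*ᶠ v₁ v₀) ⟨
    v₀ *ᶠ v₁ +ᶠ -ᶠ (v₁ *ᶠ v₀)         ≡⟨ cong (λ z → v₀ *ᶠ v₁ +ᶠ -ᶠ z) (*ᶠ-comm v₁ v₀) ⟩
    v₀ *ᶠ v₁ +ᶠ -ᶠ (v₀ *ᶠ v₁)         ≡⟨ +ᶠ-inverseʳ (v₀ *ᶠ v₁) ⟩
    0ᶠ                                ∎)
    where open ≡-Reasoning

  -- The points compared are (a,0) and (2a,0), where a is a nonzero zero of the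
  -- first part v of u.
  vanishing-on-hyperplane : 2 ≤ m → ∀ u s′ u′ →
    (∀ x → u ∙ x ≡ 0ᶠ → value s′ u′ x ≡ 0ᶠ) → s′ ≡ 0ᶠ
  vanishing-on-hyperplane 2≤m u s′ u′ H with Vec.splitAt m u | Vec.splitAt m u′
  ... | v , w , refl | v′ , w′ , refl with orthogonal 2≤m v
  ...   | a , a≢𝟎 , va≡0 = begin
    s′               ≡⟨ +ᶠ-identityʳ s′ ⟨
    s′ +ᶠ 0ᶠ         ≡⟨ cong (s′ +ᶠ_) v′a≡0 ⟨
    s′ +ᶠ v′ ∙ a     ≡⟨ at a a≢𝟎 va≡0 ⟩
    0ᶠ               ∎
    where
    open ≡-Reasoning
    at : ∀ a → a ≢ 𝟎 → v ∙ a ≡ 0ᶠ → s′ +ᶠ v′ ∙ a ≡ 0ᶠ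
    at a a≢𝟎 va≡0 = begin
      s′ +ᶠ v′ ∙ a                     ≡⟨ cong (s′ +ᶠ_) (∙-++𝟎 v′ a w′) ⟨
      s′ +ᶠ (v′ ++ w′) ∙ (a ++ 𝟎)      ≡⟨ value-true s′ (v′ ++ w′) (f-a𝟎 a a≢𝟎) ⟨
      value s′ (v′ ++ w′) (a ++ 𝟎)     ≡⟨ H (a ++ 𝟎) (trans (∙-++𝟎 v a w) va≡0) ⟩
      0ᶠ                               ∎
    a+a≢𝟎 : a +ᵛ a ≢ 𝟎
    a+a≢𝟎 eq = a≢𝟎 (lookup≡0⇒𝟎 a λ i → double≡0 (trans (sym (Vec.lookup-zipWith _+ᶠ_ i a a))
      (trans (cong (λ z → lookup z i) eq) (Vec.lookup-replicate i 0ᶠ))))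
    v′a≡0 : v′ ∙ a ≡ 0ᶠ
    v′a≡0 = begin
      v′ ∙ a                           ≡⟨ +ᶠ-identityˡ (v′ ∙ a) ⟨
      0ᶠ +ᶠ v′ ∙ a                     ≡⟨ cong (_+ᶠ v′ ∙ a) (at a a≢𝟎 va≡0) ⟨
      (s′ +ᶠ v′ ∙ a) +ᶠ v′ ∙ a         ≡⟨ +ᶠ-assoc s′ (v′ ∙ a) (v′ ∙ a) ⟩
      s′ +ᶠ (v′ ∙ a +ᶠ v′ ∙ a)         ≡⟨ cong (s′ +ᶠ_) (∙-distribˡ v′ a a) ⟨
      s′ +ᶠ v′ ∙ (a +ᵛ a)              ≡⟨ at (a +ᵛ a) a+a≢𝟎 (trans (∙-distribˡ v a a)
                                            (trans (cong₂ _+ᶠ_ va≡0 va≡0) (+ᶠ-identityˡ 0ᶠ))) ⟩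
      0ᶠ                               ∎

  single-has-zero : ∀ {k} → 2 ≤ k → (i : Fin k) → ∀ t → ¬ All (_≢ 0ᶠ) (single i t)
  single-has-zero (ℕ.s≤s (ℕ.s≤s _)) zero    t (_ ∷ 0≢0 ∷ _) = 0≢0 refl
  single-has-zero (ℕ.s≤s (ℕ.s≤s _)) (suc i) t (0≢0 ∷ _)     = 0≢0 refl

  -- For s ≠ 0 the zeros of s f(x) + u·x span 𝔽^n, stated as in
  -- affine-hyperplane-spans.  Write u = (v,w) and u' = (v',w').
  --  * v ≠ 0: the zeros (a,0) with v·a = -s give v' = 0.  For b ≠ 0 some multiple
  --    a of a unit vector has v·a = -w·b, and (a,b) is a zero outside I(𝔾ℙ)
  --    since m ≥ 2; this gives w'·b = 0.
  --  * v = 0, w ≠ 0: every (a,b) with w·b = -s and no zero coordinate in a is a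
  --    zero.  Taking for a the vectors with 1 everywhere except 1 or 2 at i gives
  --    v'ᵢ = 0, and the points b of the affine hyperplane then give w' = 0.
  --  * u = 0: all (a,b) outside I(𝔾ℙ) are zeros.
  zeros-span : 2 ≤ m → 1 ≤ r → ∀ {s} u u′ → s ≢ 0ᶠ →
    (∀ x → value s u x ≡ 0ᶠ → u′ ∙ x ≡ 0ᶠ) → u′ ≡ 𝟎
  zeros-span 2≤m 1≤r {s} u u′ s≢0 H with Vec.splitAt m u | Vec.splitAt m u′
  ... | v , w , refl | v′ , w′ , refl = trans (cong₂ _++_ v′≡𝟎 w′≡𝟎) (𝟎-++ m r)
    where
    open ≡-Reasoning
    -s≢0 : -ᶠ s ≢ 0ᶠ
    -s≢0 = -ᶠ≢0 s≢0
    inside : ∀ x → f x ≡ 1ᶠ → (v ++ w) ∙ x ≡ -ᶠ s → value s (v ++ w) x ≡ 0ᶠ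
    inside x fx≡1 ux≡-s = trans (value-true s (v ++ w) fx≡1)
      (trans (cong (s +ᶠ_) ux≡-s) (+ᶠ-inverseʳ s))
    inside-a𝟎 : ∀ a → v ∙ a ≡ -ᶠ s → v′ ∙ a ≡ 0ᶠ
    inside-a𝟎 a va≡-s = trans (sym (∙-++𝟎 v′ a w′))
      (H (a ++ 𝟎) (inside (a ++ 𝟎) (f-a𝟎 a a≢𝟎) (trans (∙-++𝟎 v a w) va≡-s)))
      where
      a≢𝟎 : a ≢ 𝟎
      a≢𝟎 refl = -s≢0 (trans (sym va≡-s) (∙-zeroʳ v))
    inside-full : ∀ a b → All (_≢ 0ᶠ) a → b ≢ 𝟎 → v ∙ a +ᶠ w ∙ b ≡ -ᶠ s → v′ ∙ a +ᶠ w′ ∙ b ≡ 0ᶠ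
    inside-full a b a∈ b≢𝟎 eq = trans (sym (∙-++ v′ a w′ b))
      (H (a ++ b) (inside (a ++ b) (f-full a b a∈ b≢𝟎) (trans (∙-++ v a w b) eq)))
    outside : ∀ a b → ¬ All (_≢ 0ᶠ) a → b ≢ 𝟎 → v ∙ a +ᶠ w ∙ b ≡ 0ᶠ → v′ ∙ a +ᶠ w′ ∙ b ≡ 0ᶠ
    outside a b a∉ b≢𝟎 eq = trans (sym (∙-++ v′ a w′ b))
      (H (a ++ b) (trans (value-false s (v ++ w) (f-outside a b a∉ b≢𝟎)) (trans (∙-++ v a w b) eq)))
    both : v′ ≡ 𝟎 × w′ ≡ 𝟎
    both with v ≟ᵛ 𝟎 | w ≟ᵛ 𝟎
    ... | no v≢𝟎 | _ = v′≡𝟎 , ∙-nondegenerate w′ on-b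
      where
      v′≡𝟎 : v′ ≡ 𝟎
      v′≡𝟎 = affine-hyperplane-spans v v′ v≢𝟎 -s≢0 inside-a𝟎
      on-b : ∀ b → w′ ∙ b ≡ 0ᶠ
      on-b b with b ≟ᵛ 𝟎 | ≢𝟎⇒∃≢0 v v≢𝟎
      ... | yes refl | _ = ∙-zeroʳ w′
      ... | no b≢𝟎 | i , vᵢ≢0 with inverse (lookup v i) vᵢ≢0
      ...   | y , vᵢy≡1 = begin
        w′ ∙ b                  ≡⟨ +ᶠ-identityˡ (w′ ∙ b) ⟨
        0ᶠ +ᶠ w′ ∙ b            ≡⟨ cong (_+ᶠ w′ ∙ b) (trans (cong (_∙ a) v′≡𝟎) (∙-zeroˡ a)) ⟨
        v′ ∙ a +ᶠ w′ ∙ b        ≡⟨ outside a b (single-has-zero 2≤m i t) b≢𝟎 va+wb≡0 ⟩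
        0ᶠ                      ∎
        where
        t = y *ᶠ (-ᶠ (w ∙ b))
        a = single i t
        va+wb≡0 : v ∙ a +ᶠ w ∙ b ≡ 0ᶠ
        va+wb≡0 = trans (cong (_+ᶠ w ∙ b) (trans (∙-single v i t)
          (inverse-cancels (lookup v i) y (-ᶠ (w ∙ b)) vᵢy≡1))) (+ᶠ-inverseˡ (w ∙ b))
    ... | yes refl | no w≢𝟎 = v′≡𝟎 , affine-hyperplane-spans w w′ w≢𝟎 -s≢0 on-b
      where
      b₀ = proj₁ (∙-surjective w w≢𝟎 (-ᶠ s))
      wb₀≡-s : w ∙ b₀ ≡ -ᶠ s
      wb₀≡-s = proj₂ (∙-surjective w w≢𝟎 (-ᶠ s))
      at : ∀ a → All (_≢ 0ᶠ) a → ∀ b → w ∙ b ≡ -ᶠ s → v′ ∙ a +ᶠ w′ ∙ b ≡ 0ᶠ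
      at a a∈ b wb≡-s = inside-full a b a∈
        (λ { refl → -s≢0 (trans (sym wb≡-s) (∙-zeroʳ w)) })
        (trans (cong (_+ᶠ w ∙ b) (∙-zeroˡ a)) (trans (+ᶠ-identityˡ (w ∙ b)) wb≡-s))
      ones : 𝔽^ m
      ones = Vec.replicate m 1ᶠ
      ones-full : All (_≢ 0ᶠ) ones
      ones-full = All.lookup⁻ λ i → subst (_≢ 0ᶠ) (sym (Vec.lookup-replicate i 1ᶠ)) 1ᶠ≢0
      ones+single-full : ∀ {k} (i : Fin k) → All (_≢ 0ᶠ) (single i 1ᶠ +ᵛ Vec.replicate k 1ᶠ)
      ones+single-full {ℕ.suc k} zero = 2ᶠ≢0 ∷ All.lookup⁻ λ j → subst (_≢ 0ᶠ)
        (sym (trans (Vec.lookup-zipWith _+ᶠ_ j 𝟎 (Vec.replicate k 1ᶠ))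
          (trans (cong₂ _+ᶠ_ (Vec.lookup-replicate j 0ᶠ) (Vec.lookup-replicate j 1ᶠ))
            (+ᶠ-identityˡ 1ᶠ)))) 1ᶠ≢0
      ones+single-full {ℕ.suc k} (suc i) =
        subst (_≢ 0ᶠ) (sym (+ᶠ-identityˡ 1ᶠ)) 1ᶠ≢0 ∷ ones+single-full i
      v′≡𝟎 : v′ ≡ 𝟎
      v′≡𝟎 = lookup≡0⇒𝟎 v′ λ i → begin
        lookup v′ i                                        ≡⟨ *ᶠ-identityʳ (lookup v′ i) ⟨
        lookup v′ i *ᶠ 1ᶠ                                  ≡⟨ ∙-single v′ i 1ᶠ ⟨
        v′ ∙ single i 1ᶠ                                   ≡⟨ +ᶠ-identityʳ (v′ ∙ single i 1ᶠ) ⟨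
        v′ ∙ single i 1ᶠ +ᶠ 0ᶠ
          ≡⟨ cong (v′ ∙ single i 1ᶠ +ᶠ_) (at ones ones-full b₀ wb₀≡-s) ⟨
        v′ ∙ single i 1ᶠ +ᶠ (v′ ∙ ones +ᶠ w′ ∙ b₀)
          ≡⟨ +ᶠ-assoc (v′ ∙ single i 1ᶠ) (v′ ∙ ones) (w′ ∙ b₀) ⟨
        (v′ ∙ single i 1ᶠ +ᶠ v′ ∙ ones) +ᶠ w′ ∙ b₀
          ≡⟨ cong (_+ᶠ w′ ∙ b₀) (∙-distribˡ v′ (single i 1ᶠ) ones) ⟨
        v′ ∙ (single i 1ᶠ +ᵛ ones) +ᶠ w′ ∙ b₀
          ≡⟨ at (single i 1ᶠ +ᵛ ones) (ones+single-full i) b₀ wb₀≡-s ⟩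
        0ᶠ  ∎
      on-b : ∀ b → w ∙ b ≡ -ᶠ s → w′ ∙ b ≡ 0ᶠ
      on-b b wb≡-s = begin
        w′ ∙ b                   ≡⟨ +ᶠ-identityˡ (w′ ∙ b) ⟨
        0ᶠ +ᶠ w′ ∙ b
          ≡⟨ cong (_+ᶠ w′ ∙ b) (trans (cong (_∙ ones) v′≡𝟎) (∙-zeroˡ ones)) ⟨
        v′ ∙ ones +ᶠ w′ ∙ b      ≡⟨ at ones ones-full b wb≡-s ⟩
        0ᶠ                       ∎
    ... | yes refl | yes refl = v′≡𝟎 , w′≡𝟎
      where
      at : ∀ a b → ¬ All (_≢ 0ᶠ) a → b ≢ 𝟎 → v′ ∙ a +ᶠ w′ ∙ b ≡ 0ᶠ
      at a b a∉ b≢𝟎 = outside a b a∉ b≢𝟎 (trans (cong₂ _+ᶠ_ (∙-zeroˡ a) (∙-zeroˡ b)) (+ᶠ-identityˡ 0ᶠ))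
      𝟎-has-zero : ∀ {k} → 2 ≤ k → ¬ All (_≢ 0ᶠ) (𝟎 {k})
      𝟎-has-zero (ℕ.s≤s _) (0≢0 ∷ _) = 0≢0 refl
      w′≡𝟎 : w′ ≡ 𝟎
      w′≡𝟎 = ∙-nondegenerate w′ on-b
        where
        on-b : ∀ b → w′ ∙ b ≡ 0ᶠ
        on-b b with b ≟ᵛ 𝟎
        ... | yes refl = ∙-zeroʳ w′
        ... | no b≢𝟎   = trans (sym (trans (cong (_+ᶠ w′ ∙ b) (∙-zeroʳ v′)) (+ᶠ-identityˡ (w′ ∙ b))))
                               (at 𝟎 b (𝟎-has-zero 2≤m) b≢𝟎)
      ones≢𝟎 : ∀ {k} → 1 ≤ k → Vec.replicate k 1ᶠ ≢ 𝟎
      ones≢𝟎 (ℕ.s≤s _) eq = 1ᶠ≢0 (Vec.∷-injectiveˡ eq)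
      v′≡𝟎 : v′ ≡ 𝟎
      v′≡𝟎 = lookup≡0⇒𝟎 v′ λ i → begin
        lookup v′ i                        ≡⟨ *ᶠ-identityʳ (lookup v′ i) ⟨
        lookup v′ i *ᶠ 1ᶠ                  ≡⟨ ∙-single v′ i 1ᶠ ⟨
        v′ ∙ single i 1ᶠ                   ≡⟨ +ᶠ-identityʳ (v′ ∙ single i 1ᶠ) ⟨
        v′ ∙ single i 1ᶠ +ᶠ 0ᶠ
          ≡⟨ cong (v′ ∙ single i 1ᶠ +ᶠ_) (trans (cong (_∙ ones) w′≡𝟎) (∙-zeroˡ ones)) ⟨
        v′ ∙ single i 1ᶠ +ᶠ w′ ∙ ones
          ≡⟨ at (single i 1ᶠ) ones (single-has-zero 2≤m i 1ᶠ) (ones≢𝟎 1≤r) ⟩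
        0ᶠ                                 ∎
        where
        ones : 𝔽^ r
        ones = Vec.replicate r 1ᶠ
    v′≡𝟎 = proj₁ both
    w′≡𝟎 = proj₂ both

  value-*ˡ : ∀ a s u x → value (a *ᶠ s) (a *ᵛ u) x ≡ a *ᶠ value s u x
  value-*ˡ a s u x = ∙-*ˡ a (s ∷ u) (f x ∷ x)

  value-+ : ∀ s u s′ u′ x → value (s +ᶠ s′) (u +ᵛ u′) x ≡ value s u x +ᶠ value s′ u′ x
  value-+ s u s′ u′ x = ∙-distribʳ (f x ∷ x) (s ∷ u) (s′ ∷ u′)

  -- The statement of minimality in terms of parameters (s,u) and zero sets.
  zeros-contained⇒multiple : 2 ≤ m → 1 ≤ r → ∀ s u s′ u′ → ¬ (s ≡ 0ᶠ × u ≡ 𝟎) →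
    (∀ x → value s u x ≡ 0ᶠ → value s′ u′ x ≡ 0ᶠ) → ∃ λ a → s′ ≡ a *ᶠ s × u′ ≡ a *ᵛ u
  zeros-contained⇒multiple 2≤m 1≤r s u s′ u′ su≢0 H with s Fin.≟ 0ᶠ
  ... | yes refl = let a , u′≡au = hyperplane-multiple u u′ u≢𝟎 on-hyperplane
                   in a , trans s′≡0 (sym (*ᶠ-zeroʳ a)) , u′≡au
    where
    u≢𝟎 : u ≢ 𝟎
    u≢𝟎 u≡𝟎 = su≢0 (refl , u≡𝟎)
    H₀ : ∀ x → u ∙ x ≡ 0ᶠ → value s′ u′ x ≡ 0ᶠ
    H₀ x ux≡0 = H x (trans (cong (_+ᶠ u ∙ x) (*ᶠ-zeroˡ (f x))) (trans (+ᶠ-identityˡ (u ∙ x)) ux≡0))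
    s′≡0 : s′ ≡ 0ᶠ
    s′≡0 = vanishing-on-hyperplane 2≤m u s′ u′ H₀
    on-hyperplane : ∀ x → u ∙ x ≡ 0ᶠ → u′ ∙ x ≡ 0ᶠ
    on-hyperplane x ux≡0 = trans (sym (trans
      (cong (_+ᶠ u′ ∙ x) (trans (cong (_*ᶠ f x) s′≡0) (*ᶠ-zeroˡ (f x)))) (+ᶠ-identityˡ (u′ ∙ x))))
      (H₀ x ux≡0)
  ... | no s≢0 with inverse s s≢0
  ...   | y , sy≡1 = a , s′≡as , u′≡au
    where
    open ≡-Reasoning
    a = s′ *ᶠ y
    s′≡as : s′ ≡ a *ᶠ s
    s′≡as = sym (trans (*ᶠ-assoc s′ y s)
      (trans (cong (s′ *ᶠ_) (trans (*ᶠ-comm y s) sy≡1)) (*ᶠ-identityʳ s′)))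
    -- The form u' - a u belongs to the codeword c(s',u') - a c(s,u), whose first
    -- parameter is 0.
    u″ : 𝔽^ n
    u″ = u′ +ᵛ (-ᶠ 1ᶠ) *ᵛ (a *ᵛ u)
    -1* : ∀ z → (-ᶠ 1ᶠ) *ᶠ z ≡ -ᶠ z
    -1* z = trans (sym (-ᶠ-distribˡ-*ᶠ 1ᶠ z)) (cong -ᶠ_ (*ᶠ-identityˡ z))
    u″≡𝟎 : u″ ≡ 𝟎
    u″≡𝟎 = zeros-span 2≤m 1≤r u u″ s≢0 λ x val≡0 → begin
      u″ ∙ x                                          ≡⟨ ∙-distribʳ x u′ ((-ᶠ 1ᶠ) *ᵛ (a *ᵛ u)) ⟩
      u′ ∙ x +ᶠ ((-ᶠ 1ᶠ) *ᵛ (a *ᵛ u)) ∙ x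
        ≡⟨ cong₂ _+ᶠ_ (agree x val≡0) (trans (∙-*ˡ (-ᶠ 1ᶠ) (a *ᵛ u) x) (-1* ((a *ᵛ u) ∙ x))) ⟩
      (a *ᵛ u) ∙ x +ᶠ -ᶠ ((a *ᵛ u) ∙ x)               ≡⟨ +ᶠ-inverseʳ ((a *ᵛ u) ∙ x) ⟩
      0ᶠ                                              ∎
      where
      agree : ∀ x → value s u x ≡ 0ᶠ → u′ ∙ x ≡ (a *ᵛ u) ∙ x
      agree x val≡0 = +ᶠ-cancelˡ (s′ *ᶠ f x) (u′ ∙ x) ((a *ᵛ u) ∙ x) (begin
        value s′ u′ x                          ≡⟨ H x val≡0 ⟩
        0ᶠ                                     ≡⟨ *ᶠ-zeroʳ a ⟨
        a *ᶠ 0ᶠ                                ≡⟨ cong (a *ᶠ_) val≡0 ⟨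
        a *ᶠ value s u x                       ≡⟨ value-*ˡ a s u x ⟨
        value (a *ᶠ s) (a *ᵛ u) x              ≡⟨ cong (λ z → value z (a *ᵛ u) x) s′≡as ⟨
        value s′ (a *ᵛ u) x                    ∎)
    u′≡au : u′ ≡ a *ᵛ u
    u′≡au = lookup-ext λ i → x-y≡0⇒x≡y (lookup u′ i) (lookup (a *ᵛ u) i) (begin
      lookup u′ i +ᶠ -ᶠ (lookup (a *ᵛ u) i)   ≡⟨ cong (lookup u′ i +ᶠ_)
          (trans (Vec.lookup-map i ((-ᶠ 1ᶠ) *ᶠ_) (a *ᵛ u)) (-1* (lookup (a *ᵛ u) i))) ⟨
      lookup u′ i +ᶠ lookup ((-ᶠ 1ᶠ) *ᵛ (a *ᵛ u)) i
        ≡⟨ Vec.lookup-zipWith _+ᶠ_ i u′ ((-ᶠ 1ᶠ) *ᵛ (a *ᵛ u)) ⟨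
      lookup u″ i                             ≡⟨ cong (λ z → lookup z i) u″≡𝟎 ⟩
      lookup 𝟎 i                              ≡⟨ Vec.lookup-replicate i 0ᶠ ⟩
      0ᶠ                                      ∎)

  -- Parameters and minimality of the code

  -- The length of the code.
  L : ℕ
  L = length (nonzeroVectors n)

  -- The nonzero vectors, which index the coordinates.
  points : Vec (𝔽^ n) L
  points = fromList (nonzeroVectors n)

  c : 𝔽 → 𝔽^ n → 𝔽^ L
  c = codeword f

  lookup-c : ∀ s u j → lookup (c s u) j ≡ value s u (lookup points j)
  lookup-c s u j = Vec.lookup-map j (value s u) points

  lookup-fromList : {x : A} {xs : List A} → x List.∈ xs → ∃ λ j → lookup (fromList xs) j ≡ x
  lookup-fromList (here refl) = zero , refl
  lookup-fromList (there x∈)  = let j , eq = lookup-fromList x∈ in suc j , eq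

  ∈-allVectors : ∀ {k} (x : 𝔽^ k) → x List.∈ allVectors k
  ∈-allVectors []      = here refl
  ∈-allVectors (t ∷ x) = ∈-cartesianProductWith⁺ _∷_ (∈-allFin t) (∈-allVectors x)

  points-complete : ∀ x → x ≢ 𝟎 → ∃ λ j → lookup points j ≡ x
  points-complete x x≢𝟎 = lookup-fromList (∈-filter⁺ (λ x → ¬? (x ≟ᵛ 𝟎)) (∈-allVectors x) x≢𝟎)

  support⇒zeros : ∀ s u s′ u′ → (∀ j → supp (c s′ u′) j → supp (c s u) j) →
    ∀ x → value s u x ≡ 0ᶠ → value s′ u′ x ≡ 0ᶠ
  support⇒zeros s u s′ u′ sub x val≡0 = by-cases (x ≟ᵛ 𝟎)
    where
    at-point : ∀ j → value s u (lookup points j) ≡ 0ᶠ → value s′ u′ (lookup points j) ≡ 0ᶠ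
    at-point j val≡0 = decidable-stable (value s′ u′ (lookup points j) Fin.≟ 0ᶠ) λ val′≢0 →
      sub j (val′≢0 ∘ trans (sym (lookup-c s′ u′ j))) (trans (lookup-c s u j) val≡0)
    by-cases : Dec (x ≡ 𝟎) → value s′ u′ x ≡ 0ᶠ
    by-cases (yes x≡𝟎) = trans (cong (value s′ u′) x≡𝟎) (value-𝟎 s′ u′)
    by-cases (no x≢𝟎)  = let j , eq = points-complete x x≢𝟎 in
      trans (cong (value s′ u′) (sym eq)) (at-point j (trans (cong (value s u) eq) val≡0))

  c≡𝟎⇒value≡0 : ∀ s u → c s u ≡ 𝟎 → ∀ x → value s u x ≡ 0ᶠ
  c≡𝟎⇒value≡0 s u c≡𝟎 x = support⇒zeros 0ᶠ 𝟎 s u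
    (λ j j∈ → contradiction (trans (cong (λ z → lookup z j) c≡𝟎) (Vec.lookup-replicate j 0ᶠ)) j∈) x
    (trans (cong₂ _+ᶠ_ (*ᶠ-zeroˡ (f x)) (∙-zeroˡ x)) (+ᶠ-identityˡ 0ᶠ))

  -- If c(s,u) = 0 then s f(x) + u·x vanishes on every hyperplane, so s = 0, and
  -- then u·x is identically 0.
  c-trivial-kernel : 2 ≤ m → ∀ s u → c s u ≡ 𝟎 → s ≡ 0ᶠ × u ≡ 𝟎
  c-trivial-kernel 2≤m s u c≡𝟎 = s≡0 , ∙-nondegenerate u λ x → begin
    u ∙ x                 ≡⟨ +ᶠ-identityˡ (u ∙ x) ⟨
    0ᶠ +ᶠ u ∙ x           ≡⟨ cong (_+ᶠ u ∙ x) (trans (cong (_*ᶠ f x) s≡0) (*ᶠ-zeroˡ (f x))) ⟨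
    value s u x           ≡⟨ vanishes x ⟩
    0ᶠ                    ∎
    where
    open ≡-Reasoning
    vanishes : ∀ x → value s u x ≡ 0ᶠ
    vanishes = c≡𝟎⇒value≡0 s u c≡𝟎
    s≡0 : s ≡ 0ᶠ
    s≡0 = vanishing-on-hyperplane 2≤m 𝟎 s u λ x _ → vanishes x

  c-0-𝟎 : c 0ᶠ 𝟎 ≡ 𝟎
  c-0-𝟎 = trans
    (Vec.map-cong (λ x → trans (cong₂ _+ᶠ_ (*ᶠ-zeroˡ (f x)) (∙-zeroˡ x)) (+ᶠ-identityˡ 0ᶠ)) points)
    (Vec.map-const points 0ᶠ)

  c-* : ∀ a s u → c (a *ᶠ s) (a *ᵛ u) ≡ a *ᵛ c s u
  c-* a s u = trans (Vec.map-cong (value-*ˡ a s u) points) (Vec.map-∘ (a *ᶠ_) (value s u) points)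

  c-+ : ∀ s u s′ u′ → c (s +ᶠ s′) (u +ᵛ u′) ≡ c s u +ᵛ c s′ u′
  c-+ s u s′ u′ = lookup-ext λ j → begin
    lookup (c (s +ᶠ s′) (u +ᵛ u′)) j                   ≡⟨ lookup-c (s +ᶠ s′) (u +ᵛ u′) j ⟩
    value (s +ᶠ s′) (u +ᵛ u′) (lookup points j)        ≡⟨ value-+ s u s′ u′ (lookup points j) ⟩
    value s u (lookup points j) +ᶠ value s′ u′ (lookup points j)
      ≡⟨ cong₂ _+ᶠ_ (lookup-c s u j) (lookup-c s′ u′ j) ⟨
    lookup (c s u) j +ᶠ lookup (c s′ u′) j
      ≡⟨ Vec.lookup-zipWith _+ᶠ_ j (c s u) (c s′ u′) ⟨
    lookup (c s u +ᵛ c s′ u′) j                        ∎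
    where open ≡-Reasoning

  isLinear : IsLinear (𝒞 f)
  isLinear = record
    { 0-closed = 0ᶠ , 𝟎 , sym c-0-𝟎
    ; +-closed = λ { (s , u , refl) (s′ , u′ , refl) → s +ᶠ s′ , u +ᵛ u′ , sym (c-+ s u s′ u′) }
    ; *-closed = λ { a (s , u , refl) → a *ᶠ s , a *ᵛ u , sym (c-* a s u) }
    }

  isMinimal : 2 ≤ m → 1 ≤ r → IsMinimal (𝒞 f)
  isMinimal 2≤m 1≤r _ (s , u , refl) c≢𝟎 _ (s′ , u′ , refl) sub =
    let a , s′≡as , u′≡au = zeros-contained⇒multiple 2≤m 1≤r s u s′ u′
          (λ { (refl , refl) → c≢𝟎 c-0-𝟎 }) (support⇒zeros s u s′ u′ λ j → sub {j})
    in a , trans (cong₂ c s′≡as u′≡au) (c-* a s u)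

  lookup-linComb : ∀ {N k} (as : 𝔽^ k) (bs : Vec (𝔽^ N) k) j →
    lookup (linComb as bs) j ≡ as ∙ Vec.map (λ b → lookup b j) bs
  lookup-linComb []       []       j = Vec.lookup-replicate j 0ᶠ
  lookup-linComb (a ∷ as) (b ∷ bs) j = trans (Vec.lookup-zipWith _+ᶠ_ j (a *ᵛ b) (linComb as bs))
    (cong₂ _+ᶠ_ (Vec.lookup-map j (a *ᶠ_) b) (lookup-linComb as bs j))

  -- The rows of the generator matrix whose column at x is (f(x),x): the first is
  -- c(1,0) and the others are the c(0,eᵢ).
  row : Fin (ℕ.suc n) → 𝔽^ L
  row i = Vec.map (λ x → lookup (f x ∷ x) i) points

  rows : Vec (𝔽^ L) (ℕ.suc n)
  rows = Vec.tabulate row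

  linComb-rows : ∀ s u → linComb (s ∷ u) rows ≡ c s u
  linComb-rows s u = lookup-ext λ j → begin
    lookup (linComb (s ∷ u) rows) j                   ≡⟨ lookup-linComb (s ∷ u) rows j ⟩
    (s ∷ u) ∙ Vec.map (λ b → lookup b j) rows         ≡⟨ cong ((s ∷ u) ∙_) (column j) ⟩
    value s u (lookup points j)                       ≡⟨ lookup-c s u j ⟨
    lookup (c s u) j                                  ∎
    where
    open ≡-Reasoning
    column : ∀ j → Vec.map (λ b → lookup b j) rows ≡ f (lookup points j) ∷ lookup points j
    column j = begin
      Vec.map (λ b → lookup b j) rows                ≡⟨ Vec.tabulate-∘ (λ b → lookup b j) row ⟨
      Vec.tabulate (λ i → lookup (row i) j)
        ≡⟨ Vec.tabulate-cong (λ i → Vec.lookup-map j (λ x → lookup (f x ∷ x) i) points) ⟩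
      Vec.tabulate (lookup (f (lookup points j) ∷ lookup points j))
        ≡⟨ Vec.tabulate∘lookup (f (lookup points j) ∷ lookup points j) ⟩
      f (lookup points j) ∷ lookup points j          ∎

  row∈𝒞 : ∀ i → 𝒞 f (row i)
  row∈𝒞 zero    = 1ᶠ , 𝟎 , Vec.map-cong (λ x → sym (begin
    1ᶠ *ᶠ f x +ᶠ 𝟎 ∙ x    ≡⟨ cong₂ _+ᶠ_ (*ᶠ-identityˡ (f x)) (∙-zeroˡ x) ⟩
    f x +ᶠ 0ᶠ             ≡⟨ +ᶠ-identityʳ (f x) ⟩
    f x                   ∎)) points
    where open ≡-Reasoning
  row∈𝒞 (suc i) = 0ᶠ , single i 1ᶠ , Vec.map-cong (λ x → sym (begin
    0ᶠ *ᶠ f x +ᶠ single i 1ᶠ ∙ x    ≡⟨ cong₂ _+ᶠ_ (*ᶠ-zeroˡ (f x)) (∙-comm (single i 1ᶠ) x) ⟩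
    0ᶠ +ᶠ x ∙ single i 1ᶠ           ≡⟨ +ᶠ-identityˡ (x ∙ single i 1ᶠ) ⟩
    x ∙ single i 1ᶠ                 ≡⟨ ∙-single x i 1ᶠ ⟩
    lookup x i *ᶠ 1ᶠ                ≡⟨ *ᶠ-identityʳ (lookup x i) ⟩
    lookup x i                      ∎)) points
    where open ≡-Reasoning

  isBasis : 2 ≤ m → IsBasis (𝒞 f) rows
  isBasis 2≤m = record
    { member      = λ i → subst (𝒞 f) (sym (Vec.lookup∘tabulate row i)) (row∈𝒞 i)
    ; independent = λ { (s ∷ u) eq →
        let s≡0 , u≡𝟎 = c-trivial-kernel 2≤m s u (trans (sym (linComb-rows s u)) eq)
        in cong₂ _∷_ s≡0 u≡𝟎 }
    ; spanning    = λ { _ (s , u , refl) → s ∷ u , sym (linComb-rows s u) }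
    }

  length-points : L ≡ p ℕ.^ n ∸ 1
  length-points = ℤ.+-injective (begin
    + L                     ≡⟨ length-nonzeroVectors n ⟩
    (+ p) ^ n - 1ℤ          ≡⟨ cong (_- 1ℤ) (pos-^ n) ⟨
    + (p ℕ.^ n) - 1ℤ        ≡⟨ ℤ.m-n≡m⊖n (p ℕ.^ n) 1 ⟩
    p ℕ.^ n ⊖ 1           ≡⟨ ℤ.⊖-≥ (ℕ.m^n>0 p n) ⟩
    + (p ℕ.^ n ∸ 1)         ∎)
    where
    open ≡-Reasoning
    pos-^ : ∀ k → + (p ℕ.^ k) ≡ (+ p) ^ k
    pos-^ ℕ.zero    = refl
    pos-^ (ℕ.suc k) = trans (ℤ.pos-* p (p ℕ.^ k)) (cong (+ p *_) (pos-^ k))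

  isCode : 2 ≤ m → Is[ p ℕ.^ n ∸ 1 , n ℕ.+ 1 ]Code (𝒞 f)
  isCode 2≤m = record
    { length≡N  = length-points
    ; isLinear  = isLinear
    ; dimension = subst (λ k → ∃ λ (bs : Vec (𝔽^ L) k) → IsBasis (𝒞 f) bs)
                        (ℕ.+-comm 1 n) (rows , isBasis 2≤m)
    }

theorem5p7 :
  ∀ (p m r : ℕ) .{{_ : NonZero p}} → Prime p → 2 ∤ p →
  let open Codes p
      n = m ℕ.+ r
  in
  3 ≤ n → 2 ≤ m → m ≤ n ∸ 1 →
  (I : 𝔽^ n) → IsUnsaturatedIdeal m I → (∀ i → toℕ (lookup I i) ≡ p ∸ 1) →
  let f = characteristic (nonzeroIdealsIn? m I)
      c = codeword f
      Q = (+ p - 1ℤ) * (+ p) ^ (n ∸ 1)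
  in
  Is[ p ℕ.^ n ∸ 1 , n ℕ.+ 1 ]Code (𝒞 f)
  × IsMinimal (𝒞 f)
  × (∀ u → u ≢ 𝟎 → + (wt (c 0ᶠ u)) ≡ Q)
  × (∀ s → s ≢ 0ᶠ →
       (+ (wt (c s 𝟎)) ≡ + (card (idealsIn? m I)) - 1ℤ)
       × (+ (card (idealsIn? m I)) - 1ℤ
            ≡ (+ p) ^ m + (+ p - 1ℤ) ^ m * ((+ p) ^ r - 1ℤ) - 1ℤ))
  × (∀ s (v : 𝔽^ m) (w : 𝔽^ r) → s ≢ 0ᶠ → v ++ w ≢ 𝟎 →
       let k = wt v
           δ = [[ w ≟ᵛ 𝟎 ]]
       in
       + (wt (c s (v ++ w)))
         ≡ Q - 1ℤ + (+ p) ^ m * [[ v ≟ᵛ 𝟎 ]]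
           + -1ℤ ^ k * (+ p - 1ℤ) ^ (m ∸ k) * ((+ p) ^ r * δ - 1ℤ))
theorem5p7 p m r p-prime p-odd 3≤n 2≤m m≤n-1 I _ I-top =
    isCode 2≤m
  , isMinimal 2≤m 1≤r
  , wt-0-u
  , (λ s s≢0 → wt-s-𝟎 s s≢0 , cong (_- 1ℤ) card-ideals)
  , (λ s v w s≢0 → wt-s-u s s≢0 v w)
  where
  open IdealCode p p-prime p-odd m r I I-top
  1≤r : 1 ≤ r
  1≤r = ℕ.+-cancelˡ-≤ m 1 r (ℕ.m≤o∸n⇒m+n≤o m (ℕ.≤-trans (ℕ.s≤s ℕ.z≤n) 3≤n) m≤n-1)
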